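{- Let $\mathcal{F}$ be a family of three connected graphs such that $\mathcal{F}$ does not contain $\{P_3\}$ as a subfamily (i.e., $P_3\notin\mathcal{F}$) and does not contain $\{K_{1,r},P_4\}$ as a subfamily for any $r\geq 3$. Then there exists a constant $C_\mathcal{F}$ such that every connected $\mathcal{F}$-free graph $G$ (of order at least $3$) satisfies $rx_3(G)\leq sdiam_3(G)+C_\mathcal{F}$ if and only if $\mathcal{F}=\{K_{1,r},Y,P_\ell\}$ for some integers $r\geq 3$, $s\geq 3$, $\ell>4$ and some graph $Y$ that is an induced subgraph of $K_s^h$.
   Context: All graphs are finite, simple, undirected. A tree in an edge-colored graph is rainbow if no two of its edges have the same color; an $S$-tree is a tree containing all vertices of $S$. A $3$-rainbow coloring of a connected graph $G$ is an edge-coloring (adjacent edges may share colors) such that every $3$-element vertex set $S$ has a rainbow $S$-tree; $rx_3(G)$ is the minimum number of colors in such a coloring. $sdiam_3(G)$ is the maximum, over all $3$-element $S\subseteq V(G)$, of the minimum number of edges of an $S$-tree. $G$ is $\mathcal{F}$-free if it has no induced subgraph isomorphic to a member of $\mathcal{F}$. $P_n$ is the path on $n$ vertices, $K_{1,r}$ the star with $r$ leaves, and $K_s^h$ is the graph obtained from the complete graph $K_s$ by attaching a pendant edge to each of its vertices (so it has $2s$ vertices).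
   Formalization: Every member of the family is additionally assumed to have at least 3 vertices; without this the claim fails, e.g. for {K_2, C_5, K_7}, where no connected graph of order at least 3 is free of the family. -}

module Defs where

open import Level using (0ℓ) renaming (suc to lsuc)
open import Data.Nat using (ℕ; suc; _+_; _≤_)
import Data.Nat.Properties as ℕ
open import Data.Fin using (Fin; zero; suc; toℕ; fromℕ; inject₁; splitAt)
open import Data.Fin.Properties using (_≟_; _<?_)
open import Data.Fin.Subset using (Subset; _∈_; ∣_∣)
open import Data.List using (List; length; filter; allFin; cartesianProduct)
open import Data.List.Relation.Unary.All using (All)
open import Data.Product using (_×_; _,_; ∃-syntax; Σ-syntax)
open import Data.Sum using (_⊎_; inj₁; inj₂; swap)
open import Data.Unit using (⊤; tt)
open import Data.Empty using (⊥)
open import Function using (_on_; Injective; _↔_; _⇔_; Inverse; mk⇔; module Equivalence)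
open import Function.Construct.Identity using (↔-id; ⇔-id)
open import Function.Construct.Symmetry using (↔-sym)
open import Relation.Binary.Core using (Rel)
open import Relation.Binary.Bundles using (Setoid)
open import Relation.Binary.Definitions using (Symmetric; Irreflexive; Decidable)
open import Relation.Binary.Construct.Closure.ReflexiveTransitive using (Star)
open import Relation.Binary.PropositionalEquality using (_≡_; refl; sym; subst₂)
open import Relation.Nullary using (¬_; yes; no; ¬?)
open import Relation.Nullary.Decidable using (_×-dec_; _⊎-dec_)
open import Relation.Unary using (Pred)

record Graph : Set₁ where
  field
    order      : ℕ
    Adj        : Rel (Fin order) 0ℓ
    Adj?       : Decidable Adj
    Adj-sym    : Symmetric Adj
    Adj-irrefl : Irreflexive _≡_ Adj

  Vertex : Set
  Vertex = Fin order

  -- Each edge is counted once, as the pair of its endpoints in increasing order.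
  size : ℕ
  size = length (filter (λ (u , v) → (u <? v) ×-dec Adj? u v)
                        (cartesianProduct (allFin order) (allFin order)))

open Graph using (order; size; Vertex)

Connected : Graph → Set
Connected G = ∀ u v → Star (Graph.Adj G) u v

-- A cycle of length 3 + k: distinct vertices f 0, …, f (2 + k), consecutive ones
-- adjacent, and the last adjacent to the first.
HasCycle : Graph → Set
HasCycle G = ∃[ k ] Σ[ f ∈ (Fin (3 + k) → Vertex G) ]
  Injective _≡_ _≡_ f
  × (∀ i → Adj (f (inject₁ i)) (f (suc i)))
  × Adj (f (fromℕ (2 + k))) (f zero)
  where open Graph G using (Adj)

IsTree : Graph → Set
IsTree T = Connected T × ¬ HasCycle T

------------------------------------------------------------------------
-- Isomorphism and (induced) subgraphs

infix 4 _≅_ _⊑ᵢ_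

_≅_ : Rel Graph 0ℓ
G ≅ H = Σ[ φ ∈ Vertex G ↔ Vertex H ]
  (∀ u v → Graph.Adj G u v ⇔ Graph.Adj H (Inverse.to φ u) (Inverse.to φ v))

-- G has an induced subgraph isomorphic to H.
_⊑ᵢ_ : Rel Graph 0ℓ
H ⊑ᵢ G = Σ[ f ∈ (Vertex H → Vertex G) ]
  Injective _≡_ _≡_ f × (∀ u v → Graph.Adj H u v ⇔ Graph.Adj G (f u) (f v))

-- A subgraph of G (not necessarily induced) given as a graph of its own together
-- with an injective homomorphism into G.
record SubgraphEmbedding (H G : Graph) : Set where
  field
    map       : Vertex H → Vertex G
    injective : Injective _≡_ _≡_ map
    preserves : ∀ {u v} → Graph.Adj H u v → Graph.Adj G (map u) (map v)

≅-setoid : Setoid (lsuc 0ℓ) 0ℓ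
≅-setoid = record
  { Carrier = Graph
  ; _≈_ = _≅_
  ; isEquivalence = record
    { refl  =  ↔-id _ , λ u v → ⇔-id _
    ; sym   = λ {G} {H} (φ , p) → ↔-sym φ , λ u v →
        let open Inverse φ
            back : ∀ x y → Graph.Adj H x y ⇔ Graph.Adj H (to (from x)) (to (from y))
            back x y = mk⇔
              (subst₂ (Graph.Adj H) (sym (strictlyInverseˡ x)) (sym (strictlyInverseˡ y)))
              (subst₂ (Graph.Adj H) (strictlyInverseˡ x) (strictlyInverseˡ y))
        in mk⇔
          (λ a → Equivalence.from (p (from u) (from v)) (Equivalence.to (back u v) a))
          (λ a → Equivalence.from (back u v) (Equivalence.to (p (from u) (from v)) a))
    ; trans = λ (φ , p) (ψ , q) →
        record
          { to = λ u → Inverse.to ψ (Inverse.to φ u)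
          ; from = λ u → Inverse.from φ (Inverse.from ψ u)
          ; to-cong = λ { refl → refl }
          ; from-cong = λ { refl → refl }
          ; inverse = (λ { refl → Inverse.inverseˡ ψ (Inverse.inverseˡ φ refl) })
                    , (λ { refl → Inverse.inverseʳ φ (Inverse.inverseʳ ψ refl) })
          } ,
        λ u v → mk⇔
          (λ a → Equivalence.to (q _ _) (Equivalence.to (p u v) a))
          (λ a → Equivalence.from (p u v) (Equivalence.from (q _ _) a))
    }
  }

-- Families are lists of graphs read as sets up to isomorphism; ⊆ and distinctness
-- are those of ≅-setoid.
open import Data.List.Relation.Binary.Subset.Setoid ≅-setoid public using (_⊆_; _⊈_)
open import Data.List.Relation.Unary.Unique.Setoid ≅-setoid public using (Unique)

infix 4 _≐_

_≐_ : Rel (List Graph) (lsuc 0ℓ)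
F ≐ F′ = F ⊆ F′ × F′ ⊆ F

Free : List Graph → Graph → Set₁
Free F G = All (λ H → ¬ (H ⊑ᵢ G)) F

------------------------------------------------------------------------
-- P n, K₁, r and Kʰ s

P : ℕ → Graph
P n = record
  { order = n
  ; Adj = λ u v → suc (toℕ u) ≡ toℕ v ⊎ suc (toℕ v) ≡ toℕ u
  ; Adj? = λ u v → (suc (toℕ u) ℕ.≟ toℕ v) ⊎-dec (suc (toℕ v) ℕ.≟ toℕ u)
  ; Adj-sym = swap
  ; Adj-irrefl = λ { refl (inj₁ e) → ℕ.1+n≢n e ; refl (inj₂ e) → ℕ.1+n≢n e }
  }

K₁,_ : ℕ → Graph
K₁, r = record
  { order = suc r
  ; Adj = StarAdj
  ; Adj? = dec
  ; Adj-sym = λ {u} {v} → symm u v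
  ; Adj-irrefl = λ { {u} refl → irr u }
  }
  where
  StarAdj : Rel (Fin (suc r)) 0ℓ
  StarAdj zero    zero    = ⊥
  StarAdj zero    (suc _) = ⊤
  StarAdj (suc _) zero    = ⊤
  StarAdj (suc _) (suc _) = ⊥

  dec : Decidable StarAdj
  dec zero    zero    = no λ ()
  dec zero    (suc _) = yes tt
  dec (suc _) zero    = yes tt
  dec (suc _) (suc _) = no λ ()

  symm : ∀ u v → StarAdj u v → StarAdj v u
  symm zero    (suc _) tt = tt
  symm (suc _) zero    tt = tt

  irr : ∀ u → ¬ StarAdj u u
  irr zero    ()
  irr (suc _) ()

-- inj₁ i is the i-th vertex of the complete graph, inj₂ i its pendant neighbour.
KʰAdj : ∀ {s} → Rel (Fin s ⊎ Fin s) 0ℓ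
KʰAdj (inj₁ i) (inj₁ j) = ¬ (i ≡ j)
KʰAdj (inj₁ i) (inj₂ j) = i ≡ j
KʰAdj (inj₂ i) (inj₁ j) = i ≡ j
KʰAdj (inj₂ _) (inj₂ _) = ⊥

Kʰ : ℕ → Graph
Kʰ s = record
  { order = s + s
  ; Adj = KʰAdj on splitAt s
  ; Adj? = λ u v → dec (splitAt s u) (splitAt s v)
  ; Adj-sym = λ {u} {v} → symm (splitAt s u) (splitAt s v)
  ; Adj-irrefl = λ { {u} refl → irr (splitAt s u) }
  }
  where
  dec : Decidable (KʰAdj {s})
  dec (inj₁ i) (inj₁ j) = ¬? (i ≟ j)
  dec (inj₁ i) (inj₂ j) = i ≟ j
  dec (inj₂ i) (inj₁ j) = i ≟ j
  dec (inj₂ _) (inj₂ _) = no λ ()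

  symm : ∀ x y → KʰAdj {s} x y → KʰAdj y x
  symm (inj₁ i) (inj₁ j) i≢j e = i≢j (sym e)
  symm (inj₁ i) (inj₂ j) e = sym e
  symm (inj₂ i) (inj₁ j) e = sym e

  irr : ∀ x → ¬ KʰAdj {s} x x
  irr (inj₁ i) i≢i = i≢i refl
  irr (inj₂ _) ()

------------------------------------------------------------------------
-- Rainbow trees, rx₃ and sdiam₃

record SteinerTree (G : Graph) (S : Subset (order G)) : Set₁ where
  field
    tree      : Graph
    isTree    : IsTree tree
    embedding : SubgraphEmbedding tree G

  open SubgraphEmbedding embedding public

  field
    covers : ∀ {v} → v ∈ S → ∃[ t ] map t ≡ v

-- The colour of an edge uv is colour u v; the values at non-adjacent pairs are never
-- used. Not every colour has to occur.
record EdgeColouring (G : Graph) (k : ℕ) : Set where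
  field
    colour     : Vertex G → Vertex G → Fin k
    colour-sym : ∀ u v → colour u v ≡ colour v u

Rainbow : ∀ {G S k} → EdgeColouring G k → SteinerTree G S → Set
Rainbow c T = ∀ {u v x y} → Adj u v → Adj x y →
  colour (map u) (map v) ≡ colour (map x) (map y) →
  (u ≡ x × v ≡ y) ⊎ (u ≡ y × v ≡ x)
  where
  open EdgeColouring c
  open SteinerTree T
  open Graph tree using (Adj)

Is3RainbowColouring : ∀ {G k} → EdgeColouring G k → Set₁
Is3RainbowColouring {G} c =
  ∀ (S : Subset (order G)) → ∣ S ∣ ≡ 3 → Σ[ T ∈ SteinerTree G S ] Rainbow c T

IsMinimum IsMaximum : ∀ {ℓ} → Pred ℕ ℓ → Pred ℕ ℓ
IsMinimum Q m = Q m × (∀ j → Q j → m ≤ j)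
IsMaximum Q m = Q m × (∀ j → Q j → j ≤ m)

-- rx₃(G) = k. The minimum, like the ones below, is unique, and it exists for connected G.
Rx₃ : Graph → ℕ → Set₁
Rx₃ G = IsMinimum λ k → Σ[ c ∈ EdgeColouring G k ] Is3RainbowColouring c

-- d(S) = m
SteinerDistance : (G : Graph) → Subset (order G) → ℕ → Set₁
SteinerDistance G S = IsMinimum λ m →
  Σ[ T ∈ SteinerTree G S ] size (SteinerTree.tree T) ≡ m

-- sdiam₃(G) = d
Sdiam₃ : Graph → ℕ → Set₁
Sdiam₃ G = IsMaximum λ d →
  Σ[ S ∈ Subset (order G) ] ∣ S ∣ ≡ 3 × SteinerDistance G S d

{-# OPTIONS --safe #-}

-- For the "if" direction every G in question has rx₃(G) at most a constant. Vertices at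
-- bounded distance from a root contain no large independent set: otherwise Ramsey's theorem,
-- applied to the parents of its members, gives an induced K₁,ᵣ, an induced Kₛʰ, or a large
-- independent set one step closer to the root; and P_ℓ-freeness bounds the distances. So G
-- has disjoint D₁, D₂, D₃ of bounded size, each Dᵢ maximal independent outside the previous
-- ones, and a bounded subtree T containing them. Give the edges of T distinct colours, and
-- colour an edge from an outer vertex to z ∈ T by z. The three vertices of S are then attached
-- to T through neighbours in D₁, D₂ and D₃ respectively.
--
-- For "only if", stars, the graphs Kₙʰ and cycles have rx₃ - sdiam₃ unbounded (in Cₙ,
-- rx₃ ≥ n - 2 but sdiam₃ ≤ 3n/4 + 1), so each of them has an induced subgraph in F. These
-- members are a star, an induced subgraph of Kₙʰ and a path, hence pairwise distinct.

module Submission where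

open import Defs
open import Level using (0ℓ)
open import Data.Nat using (ℕ; zero; suc; _+_; _*_; _∸_; _⊔_; _≤_; _<_; z≤n; s≤s; s≤s⁻¹)
import Data.Nat.Properties as ℕ
open import Data.Fin using (Fin; zero; suc; toℕ; fromℕ; inject₁)
import Data.Fin as F
import Data.Fin.Properties as F
open import Data.Fin.Subset using (Subset)
import Data.Fin.Subset as Sub
import Data.Fin.Subset.Properties as Sub
open import Data.List using (List; []; _∷_; _++_; length; filter; allFin; cartesianProduct; lookup)
import Data.List as List
import Data.List.Properties as List
open import Data.List.Relation.Unary.Any as Any using (Any; here; there)
open import Data.List.Membership.Propositional using (_∈_; find)
open import Data.List.Relation.Unary.All as All using (All; []; _∷_)
import Data.List.Relation.Unary.All.Properties as All
open import Data.List.Relation.Unary.AllPairs as AllPairs using (AllPairs; []; _∷_)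
import Data.List.Relation.Unary.AllPairs.Properties as AllPairs
open import Data.List.Relation.Binary.Sublist.Propositional
  using ([]; _∷_; _∷ʳ_; ⊆-trans; minimum) renaming (_⊆_ to _⊑ₗ_)
open import Data.List.Relation.Binary.Sublist.Propositional.Properties using (All-resp-⊆; filter-⊆)
import Data.List.Relation.Unary.Unique.Propositional.Properties as Unique
open import Data.List.Membership.Propositional.Properties
  using (∈-lookup; ∈-map⁺; ∈-filter⁺; ∈-filter⁻; ∈-allFin; ∈-++⁺ˡ; ∈-++⁺ʳ; ∈-++⁻)
open import Data.List.Relation.Unary.Any.Properties using (lookup-index)
open import Data.Fin.Patterns using (0F; 1F; 2F; 3F; 4F)
open import Data.Vec as Vec using (Vec; []; _∷_; here; there)
import Data.Vec.Properties as Vec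
open import Data.Nat.Induction using (<-rec)
open import Data.Product using (_×_; _,_; ∃-syntax; Σ-syntax; proj₁; proj₂; ∃)
open import Data.Sum using (_⊎_; inj₁; inj₂; [_,_]; swap)
open import Data.Empty using (⊥; ⊥-elim)
open import Function using (_∘_; _⇔_; Injective; mk⇔; mk↔ₛ′; Equivalence; Inverse; _on_)
open import Function.Consequences.Propositional using (inverseʳ⇒injective)
open import Relation.Nullary using (¬_; Dec; yes; no; contradiction; ¬?)
open import Relation.Nullary.Decidable using (_×-dec_; _⊎-dec_; _→-dec_; toWitness; map′)
open import Relation.Binary.Core using (Rel)
open import Relation.Binary.Bundles using (Setoid)
open import Relation.Binary.Definitions using (Symmetric; Decidable; tri<; tri≈; tri>)
open import Relation.Binary.Construct.Closure.ReflexiveTransitive using (Star; ε; _◅_; _◅◅_; gmap)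
open import Relation.Binary.PropositionalEquality
  using (_≡_; _≢_; refl; sym; trans; cong; cong₂; subst; subst₂; module ≡-Reasoning)

open Graph using (order; size; Vertex; Adj; Adj?; Adj-sym; Adj-irrefl)

-- Subtrees

-- The Ramsey step has three rounds because "the parent of one vertex is adjacent to another vertex"
-- is not symmetric: for two members of an independent set either parent may see the other member,
-- and the parents may see each other. If one of the first two always happens, a single parent sees
-- many members, which is a star. If neither ever happens, pairwise adjacent parents give `Kʰ`, and
-- pairwise nonadjacent ones an independent set nearer to the root. An outer vertex has neighbours
-- in all three sets Dᵢ, so the three members of S can be assigned to the sets arbitrarily;
-- disjointness of the sets keeps the colours of the new edges apart. In the converse only estimates
-- are compared: sdiam₃ is bounded by the size of some covering tree, rx₃ by counting colours that
-- must differ. In a star or a `Kʰ` these are the colours of the pendant edges. In a cycle a rainbow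
-- tree on three vertices uses all edges of two of the arcs between them, and well-chosen triples
-- make the colours of all edges but two distinct. The cycle is longer than the order of every
-- member of F, so a member found in it misses a vertex and is a path.

infixl 6 _+leaf_

-- The leaf gets number 0 and the old vertices move up, so that its parent has the larger number, as
-- `Subtree` demands.
_+leaf_ : (T : Graph) → Vertex T → Graph
T +leaf t = record
  { order = suc (order T)
  ; Adj = A
  ; Adj? = A?
  ; Adj-sym = λ {u} {v} → A-sym u v
  ; Adj-irrefl = λ { {u} refl → A-irrefl u }
  }
  where
  A : Rel (Fin (suc (order T))) 0ℓ
  A zero    zero    = ⊥
  A zero    (suc j) = j ≡ t
  A (suc i) zero    = i ≡ t
  A (suc i) (suc j) = Adj T i j

  A? : Decidable A
  A? zero    zero    = no λ ()
  A? zero    (suc j) = j F.≟ t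
  A? (suc i) zero    = i F.≟ t
  A? (suc i) (suc j) = Adj? T i j

  A-sym : ∀ u v → A u v → A v u
  A-sym zero    (suc j) e = e
  A-sym (suc i) zero    e = e
  A-sym (suc i) (suc j) a = Adj-sym T a

  A-irrefl : ∀ u → ¬ A u u
  A-irrefl (suc i) a = Adj-irrefl T refl a

star-sym : ∀ {A : Set} {R : Rel A 0ℓ} → Symmetric R → ∀ {x y} → Star R x y → Star R y x
star-sym s ε        = ε
star-sym s (r ◅ rs) = star-sym s rs ◅◅ (s r ◅ ε)

+leaf-connected : ∀ T t → Connected T → Connected (T +leaf t)
+leaf-connected T t conn = walk
  where
  lift : ∀ i j → Star (Adj (T +leaf t)) (suc i) (suc j)
  lift i j = gmap suc (λ a → a) (conn i j)

  walk : Connected (T +leaf t)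
  walk zero    zero    = ε
  walk zero    (suc j) = refl ◅ lift t j
  walk (suc i) zero    = lift i t ◅◅ (refl ◅ ε)
  walk (suc i) (suc j) = lift i j

-- The two neighbours of a vertex on a cycle are distinct, whereas a leaf has only one.
+leaf-acyclic : ∀ T t → ¬ HasCycle T → ¬ HasCycle (T +leaf t)
+leaf-acyclic T t acyclic (k , f , f-inj , edges , closing) =
  acyclic (k , g , g-inj , g-edges , g-closing)
  where
  T′ = T +leaf t

  rev : ∀ i j → Adj T′ (f i) (f j) → Adj T′ (f j) (f i)
  rev i j = Adj-sym T′ {f i} {f j}

  only-neighbour : ∀ u v w → u ≡ zero → Adj T′ u v → Adj T′ u w → v ≡ w
  only-neighbour zero (suc v) (suc w) refl refl refl = refl

  distinct-neighbours : ∀ i j l → j ≢ l → f i ≡ zero → Adj T′ (f i) (f j) → Adj T′ (f i) (f l) → ⊥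
  distinct-neighbours i j l j≢l e a b = j≢l (f-inj (only-neighbour (f i) (f j) (f l) e a b))

  split : ∀ {n} (i : Fin (suc n)) → i ≡ zero ⊎ ∃[ j ] i ≡ suc j
  split zero    = inj₁ refl
  split (suc i) = inj₂ (i , refl)

  last : ∀ {n} (i : Fin (suc n)) → i ≡ fromℕ n ⊎ ∃[ j ] i ≡ inject₁ j
  last {zero}  zero    = inj₁ refl
  last {suc n} zero    = inj₂ (zero , refl)
  last {suc n} (suc i) with last i
  ... | inj₁ e       = inj₁ (cong suc e)
  ... | inj₂ (j , e) = inj₂ (suc j , cong suc e)

  inject₁≢suc-suc : ∀ {n} (i : Fin n) → inject₁ (inject₁ i) ≢ suc (suc i)
  inject₁≢suc-suc (suc i) e = inject₁≢suc-suc i (F.suc-injective e)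

  f≢zero : ∀ i → f i ≢ zero
  -- The two cycle neighbours of position `i` are indexed differently at position 0, at the last
  -- position and in between.
  f≢zero i fi≡0 with split i | last i
  ... | inj₁ refl | _ =
    distinct-neighbours i (suc zero) (fromℕ (2 + k)) (λ ()) fi≡0
      (edges zero) (rev (fromℕ (2 + k)) zero closing)
  ... | inj₂ (j , refl) | inj₁ refl =
    distinct-neighbours i (inject₁ j) zero (λ ()) fi≡0 (rev (inject₁ j) i (edges j)) closing
  ... | inj₂ (j , refl) | inj₂ (j′ , e) with last j
  ...   | inj₁ refl = ⊥-elim (F.fromℕ≢inject₁ e)
  ...   | inj₂ (l , refl) with F.inject₁-injective e
  ...     | refl = distinct-neighbours i (inject₁ (inject₁ l)) (suc (suc l)) (inject₁≢suc-suc l) fi≡0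
    (rev (inject₁ (inject₁ l)) i (edges (inject₁ l))) (edges (suc l))

  pred : ∀ i → ∃[ j ] f i ≡ suc j
  pred i with split (f i)
  ... | inj₁ e = contradiction e (f≢zero i)
  ... | inj₂ p = p

  g : Fin (3 + k) → Vertex T
  g i = proj₁ (pred i)

  g-inj : Injective _≡_ _≡_ g
  g-inj {i} {j} e = f-inj (trans (proj₂ (pred i)) (trans (cong suc e) (sym (proj₂ (pred j)))))

  g-edges : ∀ i → Adj T (g (inject₁ i)) (g (suc i))
  g-edges i = subst₂ (Adj T′) (proj₂ (pred _)) (proj₂ (pred _)) (edges i)

  g-closing : Adj T (g (fromℕ (2 + k))) (g zero)
  g-closing = subst₂ (Adj T′) (proj₂ (pred _)) (proj₂ (pred _)) closing

-- Vertices are numbered so that every vertex but the root has exactly one neighbour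
-- of larger number, its parent.
record Subtree (G : Graph) : Set₁ where
  field
    tree         : Graph
    isTree       : IsTree tree
    embedding    : SubgraphEmbedding tree G
    parent-unique : ∀ {u v w} → u F.< v → u F.< w → Adj tree u v → Adj tree u w → v ≡ w

  vertex : Vertex tree → Vertex G
  vertex = SubgraphEmbedding.map embedding

open Subtree using (tree; vertex)

infix 4 _∈ᵗ_ _∉ᵗ_

_∈ᵗ_ _∉ᵗ_ : ∀ {G} → Vertex G → Subtree G → Set
v ∈ᵗ T = ∃[ t ] vertex T t ≡ v
v ∉ᵗ T = ¬ (v ∈ᵗ T)

_∈ᵗ?_ : ∀ {G} (v : Vertex G) (T : Subtree G) → Dec (v ∈ᵗ T)
v ∈ᵗ? T = F.any? λ t → vertex T t F.≟ v

singleton : ∀ {G} → Vertex G → Subtree G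
singleton v = record
  { tree = record
    { order = 1 ; Adj = λ _ _ → ⊥ ; Adj? = λ _ _ → no λ ()
    ; Adj-sym = λ () ; Adj-irrefl = λ _ () }
  ; isTree = (λ { zero zero → ε }) , λ { (_ , _ , _ , _ , ()) }
  ; embedding = record
    { map = λ _ → v ; injective = λ { {zero} {zero} _ → refl } ; preserves = λ () }
  ; parent-unique = λ _ _ ()
  }

module _ {G : Graph} (T : Subtree G) (t : Vertex (tree T)) {w : Vertex G}
         (w∉T : w ∉ᵗ T) (a : Adj G (vertex T t) w) where

  addLeaf : Subtree G
  addLeaf = record
    { tree = tree T +leaf t
    ; isTree = +leaf-connected _ t (proj₁ T-isTree) , +leaf-acyclic _ t (proj₂ T-isTree)
    ; embedding = record { map = m ; injective = m-inj _ _ ; preserves = λ {u} {v} → m-pres u v }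
    ; parent-unique = λ {u} {v} {w} → unique u v w
    }
    where
    open Subtree T using () renaming (isTree to T-isTree; embedding to ι; parent-unique to uniq)

    m : Fin (suc (order (tree T))) → Vertex G
    m zero    = w
    m (suc i) = vertex T i

    m-inj : ∀ i j → m i ≡ m j → i ≡ j
    m-inj zero    zero    e = refl
    m-inj zero    (suc j) e = contradiction (j , sym e) w∉T
    m-inj (suc i) zero    e = contradiction (i , e) w∉T
    m-inj (suc i) (suc j) e = cong suc (SubgraphEmbedding.injective ι e)

    m-pres : ∀ i j → Adj (tree T +leaf t) i j → Adj G (m i) (m j)
    m-pres zero    (suc j) refl = Adj-sym G a
    m-pres (suc i) zero    refl = a
    m-pres (suc i) (suc j) b    = SubgraphEmbedding.preserves ι b

    unique : ∀ u v w → u F.< v → u F.< w →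
             Adj (tree T +leaf t) u v → Adj (tree T +leaf t) u w → v ≡ w
    unique zero    (suc v) (suc w) _       _       refl refl = refl
    unique (suc u) (suc v) (suc w) (s≤s p) (s≤s q) b c       = cong suc (uniq p q b c)

AllPairs-lookup : ∀ {A : Set} {R : Rel A 0ℓ} {xs} → Symmetric R → AllPairs R xs →
                  ∀ i j → i ≢ j → R (lookup xs i) (lookup xs j)
AllPairs-lookup s (p ∷ ps) zero    zero    i≢j = contradiction refl i≢j
AllPairs-lookup s (p ∷ ps) zero    (suc j) i≢j = All.lookup p (∈-lookup j)
AllPairs-lookup s (p ∷ ps) (suc i) zero    i≢j = s (All.lookup p (∈-lookup i))
AllPairs-lookup s (p ∷ ps) (suc i) (suc j) i≢j = AllPairs-lookup s ps i j (i≢j ∘ cong suc)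

size≤order : ∀ {G} (T : Subtree G) → size (tree T) ≤ order (tree T)
size≤order T = F.injective⇒≤ {f = λ i → proj₁ (lookup edges i)} child-injective
  where
  H = tree T
  edge? = λ ((u , v) : Vertex H × Vertex H) → (u F.<? v) ×-dec Adj? H u v
  edges = filter edge? (cartesianProduct (allFin (order H)) (allFin (order H)))

  are-edges : All (λ (u , v) → u F.< v × Adj H u v) edges
  are-edges = All.all-filter edge? (cartesianProduct (allFin (order H)) (allFin (order H)))

  distinct : AllPairs _≢_ edges
  distinct = Unique.filter⁺ edge? (Unique.cartesianProduct⁺ (Unique.allFin⁺ _) (Unique.allFin⁺ _))

  lookup-injective : ∀ i j → lookup edges i ≡ lookup edges j → i ≡ j
  lookup-injective i j e with i F.≟ j
  ... | yes i≡j = i≡j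
  ... | no  i≢j = contradiction e (AllPairs-lookup (_∘ sym) distinct i j i≢j)

  child-injective : Injective _≡_ _≡_ (λ i → proj₁ (lookup edges i))
  child-injective {i} {j} e
    with lookup edges i in eqᵢ | lookup edges j in eqⱼ
       | All.lookup are-edges (∈-lookup {xs = edges} i)
       | All.lookup are-edges (∈-lookup {xs = edges} j)
  child-injective {i} {j} refl | u , v | u , w | p , a | q , b =
    lookup-injective i j
      (trans eqᵢ (trans (cong (u ,_) (Subtree.parent-unique T p q a b)) (sym eqⱼ)))

infix 4 _⊆ᵗ_

_⊆ᵗ_ : ∀ {G} → Subtree G → Subtree G → Set
T ⊆ᵗ T′ = ∀ {v} → v ∈ᵗ T → v ∈ᵗ T′

⊆-addLeaf : ∀ {G} (T : Subtree G) t {w} (w∉T : w ∉ᵗ T) a → T ⊆ᵗ addLeaf T t w∉T a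
⊆-addLeaf T t w∉T a (i , e) = suc i , e

insert : ∀ {G} (T : Subtree G) {v w} → v ∈ᵗ T → Adj G v w →
         Σ[ T′ ∈ Subtree G ] T ⊆ᵗ T′ × w ∈ᵗ T′ × order (tree T′) ≤ suc (order (tree T))
insert T {w = w} (t , refl) a with w ∈ᵗ? T
... | yes w∈T = T , (λ p → p) , w∈T , ℕ.n≤1+n _
... | no  w∉T = addLeaf T t w∉T a , ⊆-addLeaf T t w∉T a , (zero , refl) , ℕ.≤-refl

-- The index bounds the length of the walk instead of giving it: `stay` pads a walk, so
-- `Reach G r n` is the ball of radius `n` about `r`.
data Reach (G : Graph) (r : Vertex G) : ℕ → Vertex G → Set where
  start : Reach G r 0 r
  stay  : ∀ {n x} → Reach G r n x → Reach G r (suc n) x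
  step  : ∀ {n x y} → Reach G r n x → Adj G x y → Reach G r (suc n) y

module _ {G : Graph} {r : Vertex G} where

  -- The walk is retraced from the root, and a step to a vertex already present leaves the tree
  -- alone; so the walk may leave the tree and come back without closing a cycle.
  insertReach : (T : Subtree G) → r ∈ᵗ T → ∀ {n x} → Reach G r n x →
    Σ[ T′ ∈ Subtree G ] T ⊆ᵗ T′ × x ∈ᵗ T′ × order (tree T′) ≤ n + order (tree T)
  insertReach T r∈T start    = T , (λ p → p) , r∈T , ℕ.≤-refl
  insertReach T r∈T (stay p) =
    let T′ , T⊆ , x∈ , le = insertReach T r∈T p
    in  T′ , T⊆ , x∈ , ℕ.m≤n⇒m≤1+n le
  insertReach T r∈T (step p a) =
    let T′ , T⊆ , x∈ , le = insertReach T r∈T p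
        T″ , T′⊆ , y∈ , le′ = insert T′ x∈ a
    in  T″ , T′⊆ ∘ T⊆ , y∈ , ℕ.≤-trans le′ (s≤s le)

  coveringTree : ∀ {n} xs → All (Reach G r n) xs →
    Σ[ T ∈ Subtree G ] r ∈ᵗ T × All (_∈ᵗ T) xs × order (tree T) ≤ length xs * n + 1
  coveringTree []       []       = singleton r , (zero , refl) , [] , ℕ.≤-refl
  coveringTree {n} (x ∷ xs) (p ∷ ps) =
    let T , r∈T , xs∈T , le = coveringTree xs ps
        T′ , T⊆ , x∈ , le′ = insertReach T r∈T p
    in  T′ , T⊆ r∈T , x∈ ∷ All.map T⊆ xs∈T ,
        ℕ.≤-trans le′ (ℕ.≤-trans (ℕ.+-monoʳ-≤ n le) (ℕ.≤-reflexive (sym (ℕ.+-assoc n (length xs * n) 1))))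

  reach-mono : ∀ {m n x} → m ≤ n → Reach G r m x → Reach G r n x
  reach-mono {n = zero}  z≤n      p          = p
  reach-mono {n = suc n} z≤n      p          = stay (reach-mono z≤n p)
  reach-mono             (s≤s le) (stay p)   = stay (reach-mono le p)
  reach-mono             (s≤s le) (step p a) = step (reach-mono le p) a

star⇒reach : ∀ {G r x} → Star (Adj G) r x → ∃[ n ] Reach G r n x
star⇒reach {G} w = go start w
  where
  go : ∀ {r n x y} → Reach G r n x → Star (Adj G) x y → ∃[ m ] Reach G r m y
  go p ε        = _ , p
  go p (a ◅ as) = go (step p a) as

steinerTree : ∀ {G} (T : Subtree G) {S} → (∀ {v} → v Sub.∈ S → v ∈ᵗ T) → SteinerTree G S
steinerTree T cov = record
  { tree = tree T ; isTree = Subtree.isTree T ; embedding = Subtree.embedding T ; covers = cov }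

-- Ramsey's theorem and independent sets

⊑ᵢ-trans : ∀ {G H K} → G ⊑ᵢ H → H ⊑ᵢ K → G ⊑ᵢ K
⊑ᵢ-trans (f , f-inj , p) (g , g-inj , q) = g ∘ f , f-inj ∘ g-inj , λ u v → mk⇔
  (Equivalence.to (q _ _) ∘ Equivalence.to (p u v))
  (Equivalence.from (p u v) ∘ Equivalence.from (q _ _))

≅⇒⊑ᵢ : ∀ {G H} → G ≅ H → G ⊑ᵢ H
≅⇒⊑ᵢ (φ , p) = Inverse.to φ , inverseʳ⇒injective (Inverse.to φ) (Inverse.inverseʳ φ) , p

AllPairs-resp-⊆ : ∀ {A : Set} {R : Rel A 0ℓ} {xs ys} → xs ⊑ₗ ys → AllPairs R ys → AllPairs R xs
AllPairs-resp-⊆ []         []       = []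
AllPairs-resp-⊆ (_ ∷ʳ τ)   (_ ∷ ps) = AllPairs-resp-⊆ τ ps
AllPairs-resp-⊆ (refl ∷ τ) (p ∷ ps) = All-resp-⊆ τ p ∷ AllPairs-resp-⊆ τ ps

-- The recursion follows the split of a list by the relation of its head to the other elements; a
-- target of length 0 is met by the empty list.
ramsey : ℕ → ℕ → ℕ
ramsey zero    b       = 0
ramsey (suc a) zero    = 0
ramsey (suc a) (suc b) = suc (ramsey a (suc b) + ramsey (suc a) b)

length-filter-¬ : ∀ {A : Set} {P : A → Set} (P? : ∀ x → Dec (P x)) xs →
                  length (filter P? xs) + length (filter (¬? ∘ P?) xs) ≡ length xs
length-filter-¬ P? []       = refl
length-filter-¬ P? (x ∷ xs) with P? x
... | yes _ = cong suc (length-filter-¬ P? xs)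
... | no  _ = trans (ℕ.+-suc _ _) (cong suc (length-filter-¬ P? xs))

+-split-≤ : ∀ {a b c d} → a + b ≤ c + d → a ≤ c ⊎ b ≤ d
+-split-≤ {a} {b} {c} {d} le with a ℕ.≤? c | b ℕ.≤? d
... | yes p | _     = inj₁ p
... | no  _ | yes q = inj₂ q
... | no ¬p | no ¬q = contradiction le (ℕ.<⇒≱ (ℕ.+-mono-< (ℕ.≰⇒> ¬p) (ℕ.≰⇒> ¬q)))

-- R need not be symmetric: only pairs in list order are compared.
ramsey-sublist : ∀ {A : Set} {R : Rel A 0ℓ} → Decidable R → ∀ a b xs → ramsey a b ≤ length xs →
  (∃[ ys ] ys ⊑ₗ xs × length ys ≡ a × AllPairs R ys) ⊎
  (∃[ ys ] ys ⊑ₗ xs × length ys ≡ b × AllPairs (λ x y → ¬ R x y) ys)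
ramsey-sublist R? zero    b       xs       le = inj₁ ([] , minimum xs , refl , [])
ramsey-sublist R? (suc a) zero    xs       le = inj₂ ([] , minimum xs , refl , [])
ramsey-sublist R? (suc a) (suc b) (x ∷ xs) (s≤s le)
  with +-split-≤ (ℕ.≤-trans le (ℕ.≤-reflexive (sym (length-filter-¬ (R? x) xs))))
... | inj₁ le′ with ramsey-sublist R? a (suc b) (filter (R? x) xs) le′
...   | inj₁ (ys , τ , len , ps) = inj₁
        (x ∷ ys , refl ∷ ⊆-trans τ (filter-⊆ (R? x) xs) , cong suc len ,
         All-resp-⊆ τ (All.all-filter (R? x) xs) ∷ ps)
...   | inj₂ (ys , τ , len , ps) = inj₂
        (ys , x ∷ʳ ⊆-trans τ (filter-⊆ (R? x) xs) , len , ps)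
ramsey-sublist R? (suc a) (suc b) (x ∷ xs) (s≤s le)
    | inj₂ le′ with ramsey-sublist R? (suc a) b (filter (¬? ∘ R? x) xs) le′
...   | inj₁ (ys , τ , len , ps) = inj₁
        (ys , x ∷ʳ ⊆-trans τ (filter-⊆ (¬? ∘ R? x) xs) , len , ps)
...   | inj₂ (ys , τ , len , ps) = inj₂
        (x ∷ ys , refl ∷ ⊆-trans τ (filter-⊆ (¬? ∘ R? x) xs) , cong suc len ,
         All-resp-⊆ τ (All.all-filter (¬? ∘ R? x) xs) ∷ ps)

-- For a relation that holds in list order only, the head is a common first argument by definition
-- of `AllPairs`; a common second argument has to be sought at the other end.
below-last : ∀ {A : Set} {R : Rel A 0ℓ} x xs → AllPairs R (x ∷ xs) →
  ∃[ z ] z ∈ x ∷ xs × ∃[ ys ] ys ⊑ₗ (x ∷ xs) × length ys ≡ length xs × All (λ y → R y z) ys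
below-last x []       _        = x , here refl , [] , minimum _ , refl , []
below-last x (y ∷ xs) (p ∷ ps) =
  let z , z∈ , ys , τ , len , qs = below-last y xs ps
  in  z , there z∈ , x ∷ ys , refl ∷ τ , cong suc len , All.lookup p z∈ ∷ qs

splitAt-injective : ∀ n {u v} → F.splitAt n {n} u ≡ F.splitAt n v → u ≡ v
splitAt-injective n {u} {v} e =
  trans (sym (F.join-splitAt n n u)) (trans (cong (F.join n n) e) (F.join-splitAt n n v))

module _ (G : Graph) where

  Indep : Rel (Vertex G) 0ℓ
  Indep u v = u ≢ v × ¬ Adj G u v

  Indep-sym : Symmetric Indep
  Indep-sym (u≢v , ¬a) = u≢v ∘ sym , ¬a ∘ Adj-sym G

  star-embedding : ∀ c ys → All (Adj G c) ys → AllPairs Indep ys → (K₁, length ys) ⊑ᵢ G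
  star-embedding c ys as is = f , (λ {i} {j} → f-inj i j) , f-adj
    where
    f : Fin (suc (length ys)) → Vertex G
    f zero    = c
    f (suc i) = lookup ys i

    centre : ∀ i → Adj G c (lookup ys i)
    centre i = All.lookup as (∈-lookup i)

    leaves : ∀ i j → i ≢ j → Indep (lookup ys i) (lookup ys j)
    leaves = AllPairs-lookup Indep-sym is

    f-inj : ∀ i j → f i ≡ f j → i ≡ j
    f-inj zero    zero    e = refl
    f-inj zero    (suc j) e = contradiction (centre j) (Adj-irrefl G e)
    f-inj (suc i) zero    e = contradiction (centre i) (Adj-irrefl G (sym e))
    f-inj (suc i) (suc j) e with i F.≟ j
    ... | yes i≡j = cong suc i≡j
    ... | no  i≢j = contradiction e (proj₁ (leaves i j i≢j))

    f-adj : ∀ i j → Adj (K₁, length ys) i j ⇔ Adj G (f i) (f j)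
    f-adj zero    zero    = mk⇔ (λ ()) (Adj-irrefl G refl)
    f-adj zero    (suc j) = mk⇔ (λ _ → centre j) _
    f-adj (suc i) zero    = mk⇔ (λ _ → Adj-sym G (centre i)) _
    f-adj (suc i) (suc j) = mk⇔ (λ ()) ¬leaf-edge
      where
      ¬leaf-edge : ¬ Adj G (lookup ys i) (lookup ys j)
      ¬leaf-edge a with i F.≟ j
      ... | yes refl = Adj-irrefl G refl a
      ... | no  i≢j  = proj₂ (leaves i j i≢j) a

  Kʰ-embedding : ∀ {s} (p x : Fin s → Vertex G) →
    (∀ i → Adj G (p i) (x i)) →
    (∀ i j → i ≢ j → Adj G (p i) (p j)) →
    (∀ i j → i ≢ j → ¬ Adj G (p i) (x j)) →
    (∀ i j → i ≢ j → Indep (x i) (x j)) →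
    Kʰ s ⊑ᵢ G
  Kʰ-embedding {s} p x px pp ¬px xx =
    g ∘ F.splitAt s , (λ {u} {v} e → splitAt-injective s (g-inj _ _ e)) , λ u v → g-adj _ _
    where
    g : Fin s ⊎ Fin s → Vertex G
    g = [ p , x ]

    p≢x : ∀ i j → p i ≢ x j
    p≢x i j e with i F.≟ j
    ... | yes refl = Adj-irrefl G e (px i)
    ... | no  i≢j  = proj₂ (xx j i (i≢j ∘ sym)) (subst (λ v → Adj G v (x i)) e (px i))

    g-inj : ∀ a b → g a ≡ g b → a ≡ b
    g-inj (inj₁ i) (inj₁ j) e with i F.≟ j
    ... | yes i≡j = cong inj₁ i≡j
    ... | no  i≢j = contradiction (pp i j i≢j) (Adj-irrefl G e)
    g-inj (inj₁ i) (inj₂ j) e = contradiction e (p≢x i j)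
    g-inj (inj₂ i) (inj₁ j) e = contradiction (sym e) (p≢x j i)
    g-inj (inj₂ i) (inj₂ j) e with i F.≟ j
    ... | yes i≡j = cong inj₂ i≡j
    ... | no  i≢j = contradiction e (proj₁ (xx i j i≢j))

    own-pendant : ∀ i j → Adj G (p i) (x j) → i ≡ j
    own-pendant i j a with i F.≟ j
    ... | yes i≡j = i≡j
    ... | no  i≢j = contradiction a (¬px i j i≢j)

    g-adj : ∀ a b → KʰAdj a b ⇔ Adj G (g a) (g b)
    g-adj (inj₁ i) (inj₁ j) = mk⇔ (pp i j) (λ a i≡j → Adj-irrefl G (cong p i≡j) a)
    g-adj (inj₁ i) (inj₂ j) = mk⇔ (λ { refl → px i }) (own-pendant i j)
    g-adj (inj₂ i) (inj₁ j) = mk⇔ (λ { refl → Adj-sym G (px i) })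
                                  (sym ∘ own-pendant j i ∘ Adj-sym G)
    g-adj (inj₂ i) (inj₂ j) = mk⇔ (λ ()) ¬pendant-edge
      where
      ¬pendant-edge : ¬ Adj G (x i) (x j)
      ¬pendant-edge a with i F.≟ j
      ... | yes refl = Adj-irrefl G refl a
      ... | no  i≢j  = proj₂ (xx i j i≢j) a

-- From the outside in, the Ramsey numbers serve the rounds for `R₁`, `R₂` and `R₃` below. The
-- target is `suc r` because one member supplies the centre of the star and only the others are
-- leaves. The ball of radius 0 has one vertex, and the bound is strict, hence 2.
α-bound : ℕ → ℕ → ℕ → ℕ
α-bound r s zero    = 2
α-bound r s (suc n) = ramsey (suc r) (ramsey (suc r) (ramsey s (α-bound r s n)))

module _ {G : Graph} {o : Vertex G} where

  -- Parents are read off the walk carried by the vertex. A padded walk makes the vertex its own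
  -- parent, which is why `parent-link` has two cases.
  parent : ∀ {n} → ∃ (Reach G o (suc n)) → ∃ (Reach G o n)
  parent (x , stay p)   = x , p
  parent (_ , step p _) = _ , p

  parent-link : ∀ {n} (x : ∃ (Reach G o (suc n))) →
                proj₁ (parent x) ≡ proj₁ x ⊎ Adj G (proj₁ (parent x)) (proj₁ x)
  parent-link (x , stay p)   = inj₁ refl
  parent-link (_ , step _ a) = inj₂ a

  module _ {r s} (¬star : ¬ ((K₁, r) ⊑ᵢ G)) (2≤s : 2 ≤ s) (¬Kʰ : ¬ (Kʰ s ⊑ᵢ G)) where

    independent-bound : ∀ n (xs : List (∃ (Reach G o n))) →
                        AllPairs (Indep G on proj₁) xs → length xs < α-bound r s n
    independent-bound zero []      is = s≤s z≤n
    independent-bound zero (_ ∷ []) is = s≤s (s≤s z≤n)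
    independent-bound zero ((_ , start) ∷ (_ , start) ∷ _) (((x≢x , _) ∷ _) ∷ _) =
      contradiction refl x≢x
    independent-bound (suc n) xs is with length xs ℕ.<? α-bound r s (suc n)
    ... | yes lt = lt
    ... | no  ¬lt = ⊥-elim (case₁ (ramsey-sublist (λ x y → Adj? G (p x) (v y)) (suc r) _ xs (ℕ.≮⇒≥ ¬lt)))
      where
      V = ∃ (Reach G o (suc n))

      v p : V → Vertex G
      v = proj₁
      p = proj₁ ∘ parent

      -- `AllPairs` sees each pair in list order only, so the two directions of "parent adjacent to
      -- the other vertex" become two relations.
      R₁ R₂ R₃ : Rel V 0ℓ
      R₁ x y = Adj G (p x) (v y)
      R₂ x y = Adj G (p y) (v x)
      R₃ x y = Adj G (p x) (p y)

      star : ∀ c ys → length ys ≡ r → All (λ y → Adj G c (v y)) ys →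
             AllPairs (Indep G on v) ys → ⊥
      star c ys refl as is = ¬star (subst (λ k → (K₁, k) ⊑ᵢ G) (List.length-map v ys)
        (star-embedding G c (List.map v ys) (All.map⁺ as) (AllPairs.map⁺ is)))

      case₃ : ∀ ys → AllPairs (Indep G on v) ys →
              AllPairs (λ x y → ¬ R₁ x y) ys → AllPairs (λ x y → ¬ R₂ x y) ys →
              (∃[ zs ] zs ⊑ₗ ys × length zs ≡ s × AllPairs R₃ zs) ⊎
              (∃[ zs ] zs ⊑ₗ ys × length zs ≡ α-bound r s n × AllPairs (λ x y → ¬ R₃ x y) zs) → ⊥
      case₃ ys is ¬r₁ ¬r₂ (inj₁ (zs , τ , refl , r₃)) = ¬Kʰ
        (Kʰ-embedding G (p ∘ lookup zs) (v ∘ lookup zs) links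
          (λ i j i≢j → proj₁ (Q-at i j i≢j))
          (λ i j i≢j → proj₁ (proj₂ (Q-at i j i≢j)))
          (λ i j i≢j → proj₂ (proj₂ (proj₂ (Q-at i j i≢j)))))
        where
        Q : Rel V 0ℓ
        Q x y = R₃ x y × ¬ R₁ x y × ¬ R₂ x y × Indep G (v x) (v y)

        Q-at : ∀ i j → i ≢ j → Q (lookup zs i) (lookup zs j)
        Q-at = AllPairs-lookup
          (λ (a , b , c , d) → Adj-sym G a , c , b , Indep-sym G d)
          (AllPairs.zip (r₃ , AllPairs.zip (AllPairs-resp-⊆ τ ¬r₁ ,
            AllPairs.zip (AllPairs-resp-⊆ τ ¬r₂ , AllPairs-resp-⊆ τ is))))

        another : ∀ {m} → 2 ≤ m → (i : Fin m) → ∃[ j ] i ≢ j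
        another (s≤s (s≤s _)) zero    = suc zero , λ ()
        another (s≤s (s≤s _)) (suc i) = zero , λ ()

        links : ∀ i → Adj G (p (lookup zs i)) (v (lookup zs i))
        links i with parent-link (lookup zs i)
        ... | inj₂ a = a
        -- If this vertex were its own parent, `R₃` with any other member would join it to the
        -- parent of that member, against `¬ R₂`; `2 ≤ s` provides the other member.
        ... | inj₁ e =
          let j , i≢j = another 2≤s i
              a , _ , ¬r , _ = Q-at i j i≢j
          in  contradiction (Adj-sym G (subst (λ w → Adj G w (p (lookup zs j))) e a)) ¬r
      case₃ ys is ¬r₁ ¬r₂ (inj₂ (zs , τ , len , ¬r₃)) =
        ℕ.<-irrefl (trans (List.length-map parent zs) len)
          (independent-bound n (List.map parent zs) (AllPairs.map⁺
            (AllPairs.map (λ {x} {y} → indep {x} {y}) (AllPairs.zip (AllPairs-resp-⊆ τ ¬r₁ ,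
              AllPairs.zip (¬r₃ , AllPairs-resp-⊆ τ is))))))
        where
        indep : ∀ {x y} → ¬ R₁ x y × ¬ R₃ x y × Indep G (v x) (v y) → Indep G (p x) (p y)
        indep {x} {y} (¬xy , ¬pp , x≢y , ¬adj) = distinct , ¬pp
          where
          -- If `y` is joined to its parent by an edge, a common parent contradicts `¬ R₁`.
          -- Otherwise `y` is its own parent and therefore equal or adjacent to `x`, against
          -- independence.
          distinct : p x ≢ p y
          distinct e with parent-link x | parent-link y
          ... | _       | inj₂ b  = ¬xy (subst (λ w → Adj G w (v y)) (sym e) b)
          ... | inj₁ e₁ | inj₁ e₂ = x≢y (trans (sym e₁) (trans e e₂))
          ... | inj₂ a  | inj₁ e₂ = ¬adj (Adj-sym G (subst (λ w → Adj G w (v x)) (trans e e₂) a))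

      case₂ : ∀ ys → AllPairs (Indep G on v) ys → AllPairs (λ x y → ¬ R₁ x y) ys →
              (∃[ zs ] zs ⊑ₗ ys × length zs ≡ suc r × AllPairs R₂ zs) ⊎
              (∃[ zs ] zs ⊑ₗ ys × length zs ≡ ramsey s (α-bound r s n) × AllPairs (λ x y → ¬ R₂ x y) zs) → ⊥
      case₂ ys is ¬r₁ (inj₁ (z ∷ zs , τ , refl , r₂)) =
        let w , _ , us , σ , len , as = below-last z zs r₂
        in  star (p w) us len as (AllPairs-resp-⊆ (⊆-trans σ τ) is)
      case₂ ys is ¬r₁ (inj₂ (zs , τ , len , ¬r₂)) =
        case₃ zs (AllPairs-resp-⊆ τ is) (AllPairs-resp-⊆ τ ¬r₁) ¬r₂
          (ramsey-sublist (λ x y → Adj? G (p x) (p y)) s _ zs (ℕ.≤-reflexive (sym len)))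

      case₁ : (∃[ ys ] ys ⊑ₗ xs × length ys ≡ suc r × AllPairs R₁ ys) ⊎
              (∃[ ys ] ys ⊑ₗ xs × length ys ≡ _ × AllPairs (λ x y → ¬ R₁ x y) ys) → ⊥
      case₁ (inj₁ (y ∷ ys , τ , refl , a ∷ _)) =
        star (p y) ys refl a (AllPairs.tail (AllPairs-resp-⊆ τ is))
      case₁ (inj₂ (ys , τ , len , ¬r₁)) =
        case₂ ys (AllPairs-resp-⊆ τ is) ¬r₁
          (ramsey-sublist (λ x y → Adj? G (p y) (v x)) (suc r) _ ys (ℕ.≤-reflexive (sym len)))

-- Geodesics

Reach? : ∀ G o n (x : Vertex G) → Dec (Reach G o n x)
Reach? G o zero    x = map′ (λ { refl → start }) (λ { start → refl }) (o F.≟ x)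
Reach? G o (suc n) x = map′ to from
  (Reach? G o n x ⊎-dec F.any? (λ y → Reach? G o n y ×-dec Adj? G y x))
  where
  to : Reach G o n x ⊎ ∃[ y ] Reach G o n y × Adj G y x → Reach G o (suc n) x
  to (inj₁ p)           = stay p
  to (inj₂ (_ , p , a)) = step p a

  from : Reach G o (suc n) x → Reach G o n x ⊎ ∃[ y ] Reach G o n y × Adj G y x
  from (stay p)   = inj₁ p
  from (step p a) = inj₂ (_ , p , a)

module _ {G : Graph} {o : Vertex G} where

  Distance : Vertex G → ℕ → Set
  Distance x m = Reach G o m x × (∀ k → Reach G o k x → m ≤ k)

  distance : ∀ n {x} → Reach G o n x → ∃ (Distance x)
  distance zero    p = 0 , p , λ _ _ → z≤n
  distance (suc n) {x} p with Reach? G o n x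
  ... | yes q = distance n q
  ... | no ¬q = suc n , p , λ k q → ℕ.≰⇒> (λ k≤n → ¬q (reach-mono k≤n q))

  distance-adj : ∀ {x y m n} → Distance x m → Distance y n → Adj G x y → n ≤ suc m
  distance-adj (p , _) (_ , min) a = min _ (step p a)

  -- The vertices run from `x` back to the root, the direction in which a walk is taken apart;
  -- `d + toℕ i ≡ m` avoids a subtraction. A shortest walk cannot end in `stay`.
  geodesic : ∀ m x → Distance x m → Σ[ f ∈ (Fin (suc m) → Vertex G) ]
    f zero ≡ x
    × (∀ i → ∃[ d ] d + toℕ i ≡ m × Distance (f i) d)
    × (∀ i j → suc (toℕ i) ≡ toℕ j → Adj G (f i) (f j))
  geodesic zero    x d = (λ _ → x) , refl , (λ { zero → 0 , refl , d }) , λ { zero zero () }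
  geodesic (suc m) x (stay p , min) = contradiction (min m p) (ℕ.<-irrefl refl)
  geodesic (suc m) x d@(step {x = y} p a , min)
    with geodesic m y (p , λ k q → s≤s⁻¹ (min (suc k) (step q a)))
  ... | f , refl , dist , edges = f′ , refl , dist′ , edges′
    where
    f′ : Fin (suc (suc m)) → Vertex G
    f′ zero    = x
    f′ (suc i) = f i

    dist′ : ∀ i → ∃[ e ] e + toℕ i ≡ suc m × Distance (f′ i) e
    dist′ zero    = suc m , ℕ.+-identityʳ _ , d
    dist′ (suc i) = let e , eq , de = dist i in e , trans (ℕ.+-suc e _) (cong suc eq) , de

    edges′ : ∀ i j → suc (toℕ i) ≡ toℕ j → Adj G (f′ i) (f′ j)
    edges′ zero    (suc zero) e = Adj-sym G a
    edges′ (suc i) (suc j)    e = edges i j (ℕ.suc-injective e)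

  -- Distance to the root falls by one at each vertex of the list, which excludes repetitions, and
  -- changes by at most one along an edge, which excludes chords.
  geodesic-induced : ∀ {m x} → Distance x m → P (suc m) ⊑ᵢ G
  geodesic-induced {m} {x} d with geodesic m x d
  ... | f , _ , dist , edges = f , (λ {i} {j} → f-inj i j) , λ i j → mk⇔ (to i j) (from i j)
    where
    f-inj : ∀ i j → f i ≡ f j → i ≡ j
    f-inj i j e =
      let a , eq , (p , min) = dist i
          b , eq′ , (q , min′) = dist j
          a≡b = ℕ.≤-antisym (min b (subst (Reach G o b) (sym e) q)) (min′ a (subst (Reach G o a) e p))
      in  F.toℕ-injective (ℕ.+-cancelˡ-≡ b (toℕ i) (toℕ j)
            (trans (cong (_+ toℕ i) (sym a≡b)) (trans eq (sym eq′))))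

    to : ∀ i j → Adj (P (suc m)) i j → Adj G (f i) (f j)
    to i j (inj₁ e) = edges i j e
    to i j (inj₂ e) = Adj-sym G (edges j i e)

    near : ∀ i j → Adj G (f i) (f j) → toℕ i < toℕ j → suc (toℕ i) ≡ toℕ j
    near i j a i<j =
      let b , eq , dᵢ = dist i
          c , eq′ , dⱼ = dist j
      in  ℕ.≤-antisym i<j (ℕ.+-cancelˡ-≤ c (toℕ j) (suc (toℕ i))
            (ℕ.≤-trans (ℕ.≤-reflexive (trans eq′ (sym eq)))
              (ℕ.≤-trans (ℕ.+-monoˡ-≤ (toℕ i) (distance-adj dⱼ dᵢ (Adj-sym G a)))
                (ℕ.≤-reflexive (sym (ℕ.+-suc c (toℕ i)))))))

    from : ∀ i j → Adj G (f i) (f j) → Adj (P (suc m)) i j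
    from i j a with ℕ.<-cmp (toℕ i) (toℕ j)
    ... | tri< i<j _ _ = inj₁ (near i j a i<j)
    ... | tri≈ _ e _   = contradiction a (Adj-irrefl G (cong f (F.toℕ-injective e)))
    ... | tri> _ _ j<i = inj₂ (near j i (Adj-sym G a) j<i)

Consecutive : ℕ → ℕ → Set
Consecutive a b = suc a ≡ b ⊎ suc b ≡ a

P-mono : ∀ {m n} → m ≤ n → P m ⊑ᵢ P n
P-mono le = (λ i → F.inject≤ i le) , F.inject≤-injective le le _ _ , λ i j → mk⇔
  (subst₂ Consecutive (sym (F.toℕ-inject≤ i le)) (sym (F.toℕ-inject≤ j le)))
  (subst₂ Consecutive (F.toℕ-inject≤ i le) (F.toℕ-inject≤ j le))

P-free⇒reach : ∀ {G ℓ} → Connected G → ¬ (P ℓ ⊑ᵢ G) → ∀ o x → Reach G o ℓ x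
P-free⇒reach {G} {ℓ} conn free o x with star⇒reach (conn o x)
... | n , p with distance n p
...   | m , d with m ℕ.≤? ℓ
...     | yes m≤ℓ = reach-mono m≤ℓ (proj₁ d)
...     | no  m≰ℓ = contradiction
            (⊑ᵢ-trans {P ℓ} {P (suc m)} {G} (P-mono (ℕ.m≤n⇒m≤1+n (ℕ.<⇒≤ (ℕ.≰⇒> m≰ℓ)))) (geodesic-induced d)) free

-- Rainbow colourings

-- The pair is sorted before it is encoded, so that an edge has the same colour from both ends.
code : ∀ {n} → Fin n → Fin n → Fin (n * n)
code i j with i F.≤? j
... | yes _ = F.combine i j
... | no  _ = F.combine j i

code-sym : ∀ {n} (i j : Fin n) → code i j ≡ code j i
code-sym i j with i F.≤? j | j F.≤? i
... | yes p | yes q = cong₂ F.combine (F.≤-antisym p q) (F.≤-antisym q p)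
... | yes _ | no  _ = refl
... | no  _ | yes _ = refl
... | no ¬p | no ¬q with F.≤-total i j
...   | inj₁ p = contradiction p ¬p
...   | inj₂ q = contradiction q ¬q

code-injective : ∀ {n} (i j k l : Fin n) → code i j ≡ code k l →
                 (i ≡ k × j ≡ l) ⊎ (i ≡ l × j ≡ k)
code-injective i j k l e with i F.≤? j | k F.≤? l
... | yes _ | yes _ = inj₁ (F.combine-injective i j k l e)
... | yes _ | no  _ = inj₂ (F.combine-injective i j l k e)
... | no  _ | yes _ = let p , q = F.combine-injective j i k l e in inj₂ (q , p)
... | no  _ | no  _ = let p , q = F.combine-injective j i l k e in inj₁ (q , p)

open EdgeColouring using (colour; colour-sym)

RainbowTree : ∀ {G k} → EdgeColouring G k → Subtree G → Set
RainbowTree c T = ∀ u v x y → Adj (tree T) u v → Adj (tree T) x y →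
  colour c (vertex T u) (vertex T v) ≡ colour c (vertex T x) (vertex T y) →
  (u ≡ x × v ≡ y) ⊎ (u ≡ y × v ≡ x)

addLeaf-rainbow : ∀ {G k} (c : EdgeColouring G k) T t {w} (w∉T : w ∉ᵗ T) a →
  RainbowTree c T →
  (∀ u v → Adj (tree T) u v → colour c (vertex T u) (vertex T v) ≢ colour c (vertex T t) w) →
  RainbowTree c (addLeaf T t w∉T a)
addLeaf-rainbow c T t w∉T a rb new = go
  where
  go : RainbowTree c (addLeaf T t w∉T a)
  go zero    (suc v) zero    (suc y) refl refl e = inj₁ (refl , refl)
  go zero    (suc v) (suc x) zero    refl refl e = inj₂ (refl , refl)
  go (suc u) zero    zero    (suc y) refl refl e = inj₂ (refl , refl)
  go (suc u) zero    (suc x) zero    refl refl e = inj₁ (refl , refl)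
  go zero    (suc v) (suc x) (suc y) refl b    e =
    contradiction (trans (sym e) (colour-sym c _ _)) (new x y b)
  go (suc u) zero    (suc x) (suc y) refl b    e = contradiction (sym e) (new x y b)
  go (suc u) (suc v) zero    (suc y) b    refl e =
    contradiction (trans e (colour-sym c _ _)) (new u v b)
  go (suc u) (suc v) (suc x) zero    b    refl e = contradiction e (new u v b)
  go (suc u) (suc v) (suc x) (suc y) b    b′   e with rb u v x y b b′ e
  ... | inj₁ (p , q) = inj₁ (cong suc p , cong suc q)
  ... | inj₂ (p , q) = inj₂ (cong suc p , cong suc q)

-- All vertices outside T share one index. Hence the colour of an edge with an end
-- outside T depends only on its end in T, and edges inside T get pairwise distinct colours.
module CoreColouring {G : Graph} (T : Subtree G) {N : ℕ} (order≤N : order (tree T) ≤ N) where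

  outside : Fin (suc N)
  outside = fromℕ N

  index : Vertex G → Fin (suc N)
  index v with v ∈ᵗ? T
  ... | yes (t , _) = inject₁ (F.inject≤ t order≤N)
  ... | no  _       = outside

  index-inside : ∀ {v} → v ∈ᵗ T → index v ≢ outside
  index-inside {v} v∈T e with v ∈ᵗ? T
  ... | yes _   = F.fromℕ≢inject₁ (sym e)
  ... | no  v∉T = v∉T v∈T

  index-outside : ∀ {v} → v ∉ᵗ T → index v ≡ outside
  index-outside {v} v∉T with v ∈ᵗ? T
  ... | yes v∈T = contradiction v∈T v∉T
  ... | no  _   = refl

  index-injective : ∀ {v w} → v ∈ᵗ T → w ∈ᵗ T → index v ≡ index w → v ≡ w
  index-injective {v} {w} v∈T w∈T e with v ∈ᵗ? T | w ∈ᵗ? T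
  ... | no v∉T       | _            = contradiction v∈T v∉T
  ... | yes _        | no w∉T       = contradiction w∈T w∉T
  ... | yes (s , es) | yes (t , et) = trans (sym es) (trans (cong (vertex T)
    (F.inject≤-injective order≤N order≤N s t (F.inject₁-injective e))) et)

  number-injective : ∀ i j → index (vertex T i) ≡ index (vertex T j) → i ≡ j
  number-injective i j e = SubgraphEmbedding.injective (Subtree.embedding T)
    (index-injective (i , refl) (j , refl) e)

  colouring : EdgeColouring G (suc N * suc N)
  colouring = record
    { colour = λ u v → code (index u) (index v)
    ; colour-sym = λ u v → code-sym (index u) (index v) }

  core-rainbow : RainbowTree colouring T
  core-rainbow u v x y _ _ e
    with code-injective (index (vertex T u)) (index (vertex T v))
                        (index (vertex T x)) (index (vertex T y)) e
  ... | inj₁ (p , q) = inj₁ (number-injective u x p , number-injective v y q)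
  ... | inj₂ (p , q) = inj₂ (number-injective u y p , number-injective v x q)

  -- The invariant kept while the members of S are attached one by one. `Used` collects the sets
  -- from which attaching ends were chosen, so an edge attached from a set disjoint from it has a
  -- new colour.
  record Extension (Used : Vertex G → Set) : Set₁ where
    field
      tree′   : Subtree G
      extends : T ⊆ᵗ tree′
      rainbow : RainbowTree colouring tree′
      edges   : ∀ u v → Adj (tree tree′) u v →
        (vertex tree′ u ∈ᵗ T × vertex tree′ v ∈ᵗ T) ⊎
        ∃[ z ] Used z × z ∈ᵗ T ×
          colour colouring (vertex tree′ u) (vertex tree′ v) ≡ code (index z) outside

  open Extension

  core : Extension (λ _ → ⊥)
  core = record
    { tree′ = T ; extends = λ p → p ; rainbow = core-rainbow
    ; edges = λ u v _ → inj₁ ((u , refl) , (v , refl)) }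

  attach : ∀ {Used D : Vertex G → Set} (X : Extension Used) → (∀ {z} → Used z → ¬ D z) →
    ∀ w → (w ∉ᵗ T → ∃[ z ] D z × z ∈ᵗ T × Adj G z w) →
    Σ[ Y ∈ Extension (λ z → Used z ⊎ D z) ] tree′ X ⊆ᵗ tree′ Y × w ∈ᵗ tree′ Y
  attach {Used} {D} X disjoint w neighbour with w ∈ᵗ? tree′ X
  ... | yes w∈X = record
    { tree′ = tree′ X ; extends = extends X ; rainbow = rainbow X
    ; edges = λ u v a → widen (edges X u v a) } , (λ p → p) , w∈X
    where
    widen : ∀ {A : Set} {Q : Vertex G → Set} →
            A ⊎ ∃[ z ] Used z × Q z → A ⊎ ∃[ z ] (Used z ⊎ D z) × Q z
    widen (inj₁ p)           = inj₁ p
    widen (inj₂ (z , u , q)) = inj₂ (z , inj₁ u , q)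
  ... | no w∉X = attach′ (neighbour (w∉X ∘ extends X))
    where
    w-out : index w ≡ outside
    w-out = index-outside (w∉X ∘ extends X)

    attach′ : ∃[ z ] D z × z ∈ᵗ T × Adj G z w →
      Σ[ Y ∈ Extension (λ z → Used z ⊎ D z) ] tree′ X ⊆ᵗ tree′ Y × w ∈ᵗ tree′ Y
    attach′ (z , Dz , z∈T , a) with extends X z∈T
    ... | t , refl = record
      { tree′ = Y ; extends = suc-∈ ∘ extends X
      ; rainbow = addLeaf-rainbow colouring (tree′ X) t w∉X a (rainbow X) new
      ; edges = Y-edges } , suc-∈ , (zero , refl)
      where
      Y = addLeaf (tree′ X) t w∉X a

      suc-∈ : tree′ X ⊆ᵗ Y
      suc-∈ = ⊆-addLeaf (tree′ X) t w∉X a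

      -- The new edge has an end of index `outside`, which no edge inside `T` has. Sharing its
      -- colour with an edge attached earlier would force the same end in `T`, against `disjoint`.
      new : ∀ u v → Adj (tree (tree′ X)) u v →
            colour colouring (vertex (tree′ X) u) (vertex (tree′ X) v) ≢ code (index z) (index w)
      new u v b e with edges X u v b
      ... | inj₁ (u∈T , v∈T)
        with code-injective (index (vertex (tree′ X) u)) (index (vertex (tree′ X) v))
                            (index z) (index w) e
      ...   | inj₁ (_ , q) = index-inside v∈T (trans q w-out)
      ...   | inj₂ (p , _) = index-inside u∈T (trans p w-out)
      new u v b e | inj₂ (z′ , used , z′∈T , e′)
        with code-injective (index z′) outside (index z) (index w) (trans (sym e′) e)
      ...   | inj₁ (p , _) = disjoint used (subst D (index-injective z∈T z′∈T (sym p)) Dz)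
      ...   | inj₂ (p , _) = index-inside z′∈T (trans p w-out)

      Y-edges : ∀ u v → Adj (tree Y) u v →
        (vertex Y u ∈ᵗ T × vertex Y v ∈ᵗ T) ⊎
        ∃[ z ] (Used z ⊎ D z) × z ∈ᵗ T ×
          colour colouring (vertex Y u) (vertex Y v) ≡ code (index z) outside
      Y-edges zero    (suc v) refl = inj₂ (z , inj₂ Dz , z∈T ,
        trans (code-sym (index w) (index z)) (cong (code (index z)) w-out))
      Y-edges (suc u) zero    refl = inj₂ (z , inj₂ Dz , z∈T , cong (code (index z)) w-out)
      Y-edges (suc u) (suc v) b with edges X u v b
      ... | inj₁ p                 = inj₁ p
      ... | inj₂ (z′ , used , q)   = inj₂ (z′ , inj₁ used , q)

-- Dominating independent sets and the bounded rainbow colouring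

elements : ∀ {n} (S : Subset n) →
           ∃[ xs ] length xs ≡ Sub.∣ S ∣ × (∀ {v} → v Sub.∈ S → v ∈ xs)
elements []                = [] , refl , λ ()
elements (Sub.outside ∷ S) =
  let xs , len , cov = elements S
  in  List.map suc xs , trans (List.length-map suc xs) len , λ { (there v∈S) → ∈-map⁺ suc (cov v∈S) }
elements (Sub.inside ∷ S)  =
  let xs , len , cov = elements S
  in  zero ∷ List.map suc xs , cong suc (trans (List.length-map suc xs) len) ,
      λ { here → here refl ; (there v∈S) → there (∈-map⁺ suc (cov v∈S)) }

threeElements : ∀ {n} (S : Subset n) → Sub.∣ S ∣ ≡ 3 →
                ∃[ a ] ∃[ b ] ∃[ c ] (∀ {v} → v Sub.∈ S → v ∈ a ∷ b ∷ c ∷ [])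
threeElements S e with elements S
... | xs , len , cov with xs | trans len e
...   | a ∷ b ∷ c ∷ [] | refl = a , b , c , cov

module _ (G : Graph) where

  open import Data.List.Membership.DecPropositional (F._≟_ {n = order G}) using (_∈?_)

  Dominated : List (Vertex G) → Vertex G → Set
  Dominated D v = Any (λ z → v ≡ z ⊎ Adj G z v) D

  -- Greedy choice from the end of the list: a vertex is rejected only if it is already dominated.
  maximalIndependent : ∀ xs → ∃[ D ] AllPairs (Indep G) D
    × (∀ {v} → v ∈ D → v ∈ xs) × All (Dominated D) xs
  maximalIndependent [] = [] , [] , (λ ()) , []
  maximalIndependent (x ∷ xs) with maximalIndependent xs
  ... | D , is , D⊆xs , dom with Any.any? (λ z → (x F.≟ z) ⊎-dec Adj? G z x) D
  ...   | yes d = D , is , there ∘ D⊆xs , d ∷ dom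
  ...   | no ¬d = x ∷ D , All.map (λ ¬z → ¬z ∘ inj₁ , ¬z ∘ inj₂ ∘ Adj-sym G) (All.¬Any⇒All¬ D ¬d) ∷ is ,
                  (λ { (here e) → here e ; (there p) → there (D⊆xs p) }) ,
                  here (inj₁ refl) ∷ All.map there dom

  dominated-neighbour : ∀ {D v} → Dominated D v → ¬ (v ∈ D) → ∃[ z ] z ∈ D × Adj G z v
  dominated-neighbour d v∉D with find d
  ... | z , z∈D , inj₁ refl = contradiction z∈D v∉D
  ... | z , z∈D , inj₂ a    = z , z∈D , a

  maximalIndependentAvoiding : ∀ X → ∃[ D ] AllPairs (Indep G) D × (∀ {v} → v ∈ D → ¬ (v ∈ X))
    × (∀ v → ¬ (v ∈ X) → ¬ (v ∈ D) → ∃[ z ] z ∈ D × Adj G z v)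
  maximalIndependentAvoiding X =
    let D , is , D⊆ , dom = maximalIndependent (filter avoid? (allFin (order G)))
    in  D , is , (λ v∈D → proj₂ (∈-filter⁻ avoid? {xs = allFin (order G)} (D⊆ v∈D))) ,
        λ v v∉X v∉D → dominated-neighbour (All.lookup dom (∈-filter⁺ avoid? (∈-allFin v) v∉X)) v∉D
    where
    avoid? = λ v → ¬? (v ∈? X)

-- The bound of `coveringTree` for three independent sets of at most `α-bound r s ℓ` vertices each,
-- all within distance `ℓ` of the root.
core-order : ℕ → ℕ → ℕ → ℕ
core-order r s ℓ = (α-bound r s ℓ + (α-bound r s ℓ + α-bound r s ℓ)) * ℓ + 1

module _ {G : Graph} (conn : Connected G) (o : Vertex G) {r s ℓ : ℕ}
         (¬star : ¬ ((K₁, r) ⊑ᵢ G)) (2≤s : 2 ≤ s) (¬Kʰ : ¬ (Kʰ s ⊑ᵢ G))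
         (¬path : ¬ (P ℓ ⊑ᵢ G)) where

  private
    reach : ∀ x → Reach G o ℓ x
    reach = P-free⇒reach conn ¬path o

  independent≤ : ∀ xs → AllPairs (Indep G) xs → length xs ≤ α-bound r s ℓ
  independent≤ xs is = subst (_≤ α-bound r s ℓ) (List.length-map (λ x → x , reach x) xs)
    (ℕ.<⇒≤ (independent-bound ¬star 2≤s ¬Kʰ ℓ (List.map (λ x → x , reach x) xs) (AllPairs.map⁺ is)))

  boundedRainbowColouring : let N = suc (core-order r s ℓ) in
    Σ[ c ∈ EdgeColouring G (N * N) ] Is3RainbowColouring c
  boundedRainbowColouring
    with maximalIndependentAvoiding G []
  ... | D₁ , is₁ , _ , dom₁ with maximalIndependentAvoiding G D₁
  ... | D₂ , is₂ , D₂∌D₁ , dom₂ with maximalIndependentAvoiding G (D₁ ++ D₂)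
  ... | D₃ , is₃ , D₃∌D₁₂ , dom₃
    with coveringTree (D₁ ++ D₂ ++ D₃) (All.universal reach (D₁ ++ D₂ ++ D₃))
  ... | T , _ , cov , le = colouring , rainbow₃
    where
    len : length (D₁ ++ D₂ ++ D₃) ≤ α-bound r s ℓ + (α-bound r s ℓ + α-bound r s ℓ)
    len = ℕ.≤-trans (ℕ.≤-reflexive (trans (List.length-++ D₁) (cong (length D₁ +_) (List.length-++ D₂))))
      (ℕ.+-mono-≤ (independent≤ D₁ is₁) (ℕ.+-mono-≤ (independent≤ D₂ is₂) (independent≤ D₃ is₃)))

    open CoreColouring T (ℕ.≤-trans le (ℕ.+-monoˡ-≤ 1 (ℕ.*-monoˡ-≤ ℓ len)))
    open Extension

    in₁ : ∀ {v} → v ∈ D₁ → v ∈ᵗ T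
    in₁ p = All.lookup cov (∈-++⁺ˡ p)

    in₂ : ∀ {v} → v ∈ D₂ → v ∈ᵗ T
    in₂ p = All.lookup cov (∈-++⁺ʳ D₁ (∈-++⁺ˡ p))

    in₃ : ∀ {v} → v ∈ D₃ → v ∈ᵗ T
    in₃ p = All.lookup cov (∈-++⁺ʳ D₁ (∈-++⁺ʳ D₂ p))

    in₁₂ : ∀ {v} → v ∈ D₁ ++ D₂ → v ∈ᵗ T
    in₁₂ p with ∈-++⁻ D₁ p
    ... | inj₁ q = in₁ q
    ... | inj₂ q = in₂ q

    -- A vertex outside `T` lies in no `Dᵢ`, so it was a candidate in all three choices and is
    -- dominated by a neighbour each time.
    nbr₁ : ∀ v → v ∉ᵗ T → ∃[ z ] z ∈ D₁ × z ∈ᵗ T × Adj G z v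
    nbr₁ v v∉T = let z , z∈ , a = dom₁ v (λ ()) (v∉T ∘ in₁) in z , z∈ , in₁ z∈ , a

    nbr₂ : ∀ v → v ∉ᵗ T → ∃[ z ] z ∈ D₂ × z ∈ᵗ T × Adj G z v
    nbr₂ v v∉T = let z , z∈ , a = dom₂ v (v∉T ∘ in₁) (v∉T ∘ in₂) in z , z∈ , in₂ z∈ , a

    nbr₃ : ∀ v → v ∉ᵗ T → ∃[ z ] z ∈ D₃ × z ∈ᵗ T × Adj G z v
    nbr₃ v v∉T = let z , z∈ , a = dom₃ v (v∉T ∘ in₁₂) (v∉T ∘ in₃) in z , z∈ , in₃ z∈ , a

    rainbow₃ : Is3RainbowColouring colouring
    rainbow₃ S ∣S∣≡3 =
      let a , b , c , S⊆ = threeElements S ∣S∣≡3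
          X₁ , _ , a∈ = attach {D = _∈ D₁} core (λ ()) a (nbr₁ a)
          X₂ , ⊆₂ , b∈ = attach {D = _∈ D₂} X₁ (λ { (inj₂ p) q → D₂∌D₁ q p }) b (nbr₂ b)
          X₃ , ⊆₃ , c∈ = attach {D = _∈ D₃} X₂
            (λ { (inj₁ (inj₂ p)) q → D₃∌D₁₂ q (∈-++⁺ˡ p) ; (inj₂ p) q → D₃∌D₁₂ q (∈-++⁺ʳ D₁ p) })
            c (nbr₃ c)
          covers : ∀ {v} → v ∈ a ∷ b ∷ c ∷ [] → v ∈ᵗ tree′ X₃
          covers = λ { (here refl) → ⊆₃ (⊆₂ a∈) ; (there (here refl)) → ⊆₃ b∈
                     ; (there (there (here refl))) → c∈ }
      in  steinerTree (tree′ X₃) (covers ∘ S⊆) , λ {u} {v} {x} {y} → rainbow X₃ u v x y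

-- Lower bounds for rx₃

any-vec? : ∀ {n m} {Q : Vec (Fin n) m → Set} → (∀ v → Dec (Q v)) → Dec (∃ Q)
any-vec? {m = zero}  Q? = map′ ([] ,_) (λ { ([] , q) → q }) (Q? [])
any-vec? {m = suc m} Q? = map′ (λ (x , v , q) → x ∷ v , q) (λ { (x ∷ v , q) → x , v , q })
  (F.any? λ x → any-vec? λ v → Q? (x ∷ v))

-- Decidability lets `forbidden-occurs` exhibit a member of `F`: the gap between rx₃ and sdiam₃ only
-- refutes that all members are absent.
_⊑ᵢ?_ : ∀ H G → Dec (H ⊑ᵢ G)
H ⊑ᵢ? G = map′ to from (any-vec? λ v → induced? (Vec.lookup v))
  where
  Induced : (Vertex H → Vertex G) → Set
  Induced f = ∀ i j → (f i ≡ f j → i ≡ j)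
    × (Adj H i j → Adj G (f i) (f j)) × (Adj G (f i) (f j) → Adj H i j)

  induced? : ∀ f → Dec (Induced f)
  induced? f = F.all? λ i → F.all? λ j → ((f i F.≟ f j) →-dec (i F.≟ j))
    ×-dec (Adj? H i j →-dec Adj? G (f i) (f j)) ×-dec (Adj? G (f i) (f j) →-dec Adj? H i j)

  to : ∃[ v ] Induced (Vec.lookup v) → H ⊑ᵢ G
  to (v , ind) = Vec.lookup v , (λ {i} {j} → proj₁ (ind i j)) ,
    λ i j → mk⇔ (proj₁ (proj₂ (ind i j))) (proj₂ (proj₂ (ind i j)))

  from : H ⊑ᵢ G → ∃[ v ] Induced (Vec.lookup v)
  from (f , f-inj , p) = Vec.tabulate f , λ i j →
    subst₂ (λ x y → (x ≡ y → i ≡ j) × (Adj H i j → Adj G x y) × (Adj G x y → Adj H i j))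
      (sym (Vec.lookup∘tabulate f i)) (sym (Vec.lookup∘tabulate f j))
      (f-inj , Equivalence.to (p i j) , Equivalence.from (p i j))

¬¬-minimum : ∀ {ℓ} {Q : ℕ → Set ℓ} {k} → Q k → ¬ ¬ ∃ (IsMinimum Q)
¬¬-minimum {Q = Q} {k} q none = <-rec (λ k → ¬ Q k) (λ k rec q → none (k , q , λ j qⱼ →
  ℕ.≮⇒≥ (λ j<k → rec j<k qⱼ))) k q

¬¬-maximum : ∀ {ℓ} {Q : ℕ → Set ℓ} {k B} → (∀ j → Q j → j ≤ B) → Q k → ¬ ¬ ∃ (IsMaximum Q)
¬¬-maximum {Q = Q} {k} {B} bound q none = go B k (ℕ.m≤m+n B k) q
  where
  -- Each larger witness costs one unit of fuel; when none is left, `k` has reached the bound `B`.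
  go : ∀ fuel k → B ≤ fuel + k → Q k → ⊥
  go zero       k le q = none (k , q , λ j qⱼ → ℕ.≤-trans (bound j qⱼ) le)
  go (suc fuel) k le q = none (k , q , λ j qⱼ → ℕ.≮⇒≥ λ k<j →
    go fuel j (ℕ.≤-trans le (ℕ.≤-trans (ℕ.≤-reflexive (sym (ℕ.+-suc fuel k))) (ℕ.+-monoʳ-≤ fuel k<j))) qⱼ)

∣⁅x⁆∪p∣ : ∀ {n} (x : Fin n) (p : Subset n) → x Sub.∉ p → Sub.∣ Sub.⁅ x ⁆ Sub.∪ p ∣ ≡ suc Sub.∣ p ∣
∣⁅x⁆∪p∣ zero    (Sub.inside  ∷ p) x∉p = contradiction here x∉p
∣⁅x⁆∪p∣ zero    (Sub.outside ∷ p) x∉p = cong (suc ∘ Sub.∣_∣) (Sub.∪-identityˡ p)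
∣⁅x⁆∪p∣ (suc x) (Sub.inside  ∷ p) x∉p = cong suc (∣⁅x⁆∪p∣ x p (x∉p ∘ there))
∣⁅x⁆∪p∣ (suc x) (Sub.outside ∷ p) x∉p = ∣⁅x⁆∪p∣ x p (x∉p ∘ there)

triple : ∀ {n} (a b c : Fin n) → a ≢ b → a ≢ c → b ≢ c →
         ∃[ S ] Sub.∣ S ∣ ≡ 3 × a Sub.∈ S × b Sub.∈ S × c Sub.∈ S
triple a b c a≢b a≢c b≢c =
  Sub.⁅ a ⁆ Sub.∪ (Sub.⁅ b ⁆ Sub.∪ Sub.⁅ c ⁆) ,
  trans (∣⁅x⁆∪p∣ a _ a∉) (cong suc (trans (∣⁅x⁆∪p∣ b _ (Sub.x≢y⇒x∉⁅y⁆ b≢c)) (cong suc (Sub.∣⁅x⁆∣≡1 c)))) ,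
  Sub.x∈p∪q⁺ (inj₁ (Sub.x∈⁅x⁆ a)) ,
  Sub.x∈p∪q⁺ {p = Sub.⁅ a ⁆} (inj₂ (Sub.x∈p∪q⁺ (inj₁ (Sub.x∈⁅x⁆ b)))) ,
  Sub.x∈p∪q⁺ {p = Sub.⁅ a ⁆} (inj₂ (Sub.x∈p∪q⁺ {p = Sub.⁅ b ⁆} (inj₂ (Sub.x∈⁅x⁆ c))))
  where
  a∉ : a Sub.∉ (Sub.⁅ b ⁆ Sub.∪ Sub.⁅ c ⁆)
  a∉ p with Sub.x∈p∪q⁻ Sub.⁅ b ⁆ Sub.⁅ c ⁆ p
  ... | inj₁ q = a≢b (Sub.x∈⁅y⁆⇒x≡y b q)
  ... | inj₂ q = a≢c (Sub.x∈⁅y⁆⇒x≡y c q)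

module _ (G : Graph) (conn : Connected G) (3≤n : 3 ≤ order G) where

  private
    at : Fin 3 → Vertex G
    at i = F.inject≤ i 3≤n

    at-≢ : ∀ {i j} → i ≢ j → at i ≢ at j
    at-≢ i≢j e = i≢j (F.inject≤-injective 3≤n 3≤n _ _ e)

  rainbowColouring-exists : ∃[ k ] Σ[ c ∈ EdgeColouring G k ] Is3RainbowColouring c
  rainbowColouring-exists = _ , colouring , λ S _ →
    steinerTree T (λ {v} _ → All.lookup cov (∈-allFin v)) , λ {u} {v} {x} {y} → core-rainbow u v x y
    where
    reach : ∀ x → Reach G (at zero) (suc (order G)) x
    -- A path with more vertices than `G` cannot embed, so the bound for path-free graphs applies to
    -- every connected graph and yields a spanning tree.
    reach = P-free⇒reach conn
      (λ (f , f-inj , _) → ℕ.<-irrefl refl (F.injective⇒≤ {f = f} f-inj)) (at zero)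

    spanning = coveringTree (allFin (order G)) (All.universal reach _)
    T = proj₁ spanning
    cov = proj₁ (proj₂ (proj₂ spanning))
    open CoreColouring T ℕ.≤-refl

  ¬¬Rx₃ : ¬ ¬ ∃ (Rx₃ G)
  ¬¬Rx₃ = ¬¬-minimum (proj₂ rainbowColouring-exists)

  -- rx₃ and sdiam₃ are only shown to exist up to double negation, which suffices here.
  rx₃-sdiam₃-gap : ∀ {B L C} →
    (∀ S → Sub.∣ S ∣ ≡ 3 → Σ[ T ∈ SteinerTree G S ] size (SteinerTree.tree T) ≤ B) →
    (∀ k (c : EdgeColouring G k) → Is3RainbowColouring c → L ≤ k) →
    B + C < L → ¬ (∀ k d → Rx₃ G k → Sdiam₃ G d → k ≤ d + C)
  rx₃-sdiam₃-gap {B} {L} {C} small large lt bound =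
    ¬¬Rx₃ λ (k , rx) → ¬¬Sdiam₃ λ (d , sd) →
      ℕ.<⇒≱ lt (ℕ.≤-trans (large k (proj₁ (proj₁ rx)) (proj₂ (proj₁ rx)))
        (ℕ.≤-trans (bound k d rx sd) (ℕ.+-monoˡ-≤ C (sdiam≤B d (proj₁ sd)))))
    where
    sdiam≤B : ∀ d → Σ[ S ∈ Subset (order G) ] Sub.∣ S ∣ ≡ 3 × SteinerDistance G S d → d ≤ B
    sdiam≤B d (S , e , _ , min) = let T , le = small S e in ℕ.≤-trans (min _ (T , refl)) le

    ¬¬Sdiam₃ : ¬ ¬ ∃ (Sdiam₃ G)
    ¬¬Sdiam₃ none =
      let S , e , _ = triple (at zero) (at (suc zero)) (at (suc (suc zero)))
                        (at-≢ λ ()) (at-≢ λ ()) (at-≢ λ ())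
          T , _ = small S e
      in  ¬¬-minimum {Q = λ m → Σ[ T ∈ SteinerTree G S ] size (SteinerTree.tree T) ≡ m} (T , refl)
            λ (m , dist) → ¬¬-maximum sdiam≤B (S , e , dist) none

  forbidden-occurs : ∀ {F : List Graph} {B L C} →
    (∀ S → Sub.∣ S ∣ ≡ 3 → Σ[ T ∈ SteinerTree G S ] size (SteinerTree.tree T) ≤ B) →
    (∀ k (c : EdgeColouring G k) → Is3RainbowColouring c → L ≤ k) →
    B + C < L → (Free F G → ∀ k d → Rx₃ G k → Sdiam₃ G d → k ≤ d + C) →
    Any (_⊑ᵢ G) F
  forbidden-occurs {F} small large lt bound with Any.any? (_⊑ᵢ? G) F
  ... | yes p = p
  ... | no ¬p = contradiction (bound (All.¬Any⇒All¬ F ¬p)) (rx₃-sdiam₃-gap small large lt)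

-- Graphs with many pendant edges: stars and `Kʰ`

reach⇒star : ∀ {G o n x} → Reach G o n x → Star (Adj G) o x
reach⇒star start      = ε
reach⇒star (stay p)   = reach⇒star p
reach⇒star (step p a) = reach⇒star p ◅◅ (a ◅ ε)

reach⇒connected : ∀ {G o n} → (∀ x → Reach G o n x) → Connected G
reach⇒connected {G} reach u v =
  star-sym (Adj-sym G) (reach⇒star (reach u)) ◅◅ reach⇒star (reach v)

reach⇒smallTrees : ∀ {G o n} → (∀ x → Reach G o n x) → ∀ S → Sub.∣ S ∣ ≡ 3 →
                   Σ[ T ∈ SteinerTree G S ] size (SteinerTree.tree T) ≤ 3 * n + 1
reach⇒smallTrees reach S e =
  let a , b , c , S⊆ = threeElements S e
      T , _ , cov , le = coveringTree (a ∷ b ∷ c ∷ []) (All.universal reach _)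
  in  steinerTree T (All.lookup cov ∘ S⊆) , ℕ.≤-trans (size≤order T) le

-- A tree containing two of the leaves contains both of their pendant edges.
module _ (G : Graph) {n} (3≤n : 3 ≤ n) (leaf support : Fin n → Vertex G)
         (leaf-injective : ∀ {i j} → leaf i ≡ leaf j → i ≡ j)
         (leaf≢support : ∀ i j → leaf i ≢ support j)
         (pendant : ∀ i v → Adj G (leaf i) v → v ≡ support i) where

  pendants≤colours : ∀ k (c : EdgeColouring G k) → Is3RainbowColouring c → n ≤ k
  pendants≤colours k c rainbow₃ = F.injective⇒≤ {f = pendantColour} pendantColour-injective
    where
    pendantColour : Fin n → Fin k
    pendantColour i = colour c (leaf i) (support i)

    third : ∀ {n} → 3 ≤ n → (i j : Fin n) → ∃[ l ] i ≢ l × j ≢ l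
    third (s≤s (s≤s (s≤s _))) zero          zero          = suc zero , (λ ()) , λ ()
    third (s≤s (s≤s (s≤s _))) zero          (suc zero)    = suc (suc zero) , (λ ()) , λ ()
    third (s≤s (s≤s (s≤s _))) zero          (suc (suc j)) = suc zero , (λ ()) , λ ()
    third (s≤s (s≤s (s≤s _))) (suc zero)    zero          = suc (suc zero) , (λ ()) , λ ()
    third (s≤s (s≤s (s≤s _))) (suc (suc i)) zero          = suc zero , (λ ()) , λ ()
    third (s≤s (s≤s (s≤s _))) (suc i)       (suc j)       = zero , (λ ()) , λ ()

    pendantColour-injective : ∀ {i j} → pendantColour i ≡ pendantColour j → i ≡ j
    pendantColour-injective {i} {j} e with i F.≟ j
    ... | yes i≡j = i≡j
    ... | no  i≢j =
      -- The third leaf only completes `S` to three vertices.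
      let l , i≢l , j≢l = third 3≤n i j
          S , ∣S∣≡3 , i∈S , j∈S , _ = triple (leaf i) (leaf j) (leaf l)
            (i≢j ∘ leaf-injective) (i≢l ∘ leaf-injective) (j≢l ∘ leaf-injective)
          T , rb = rainbow₃ S ∣S∣≡3
      in  clash T rb (SteinerTree.covers T i∈S) (SteinerTree.covers T j∈S)
      where
      clash : ∀ {S} (T : SteinerTree G S) → Rainbow c T → let open SteinerTree T using (map) in
        ∃[ u ] map u ≡ leaf i → ∃[ v ] map v ≡ leaf j → i ≡ j
      clash T rb (u , eᵤ) (v , eᵥ) =
        let u′ , a , eᵤ′ = pendantEdge i j i≢j u v eᵤ eᵥ
            v′ , b , eᵥ′ = pendantEdge j i (i≢j ∘ sym) v u eᵥ eᵤ
        in  conclude (rb a b (trans (cong₂ (colour c) eᵤ eᵤ′) (trans e (sym (cong₂ (colour c) eᵥ eᵥ′))))) eᵤ′ eᵥ′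
        where
        open SteinerTree T using (map; preserves; isTree) renaming (tree to H)

        pendantEdge : ∀ i j → i ≢ j → ∀ u v → map u ≡ leaf i → map v ≡ leaf j →
                      ∃[ w ] Adj H u w × map w ≡ support i
        -- The first edge of a walk in the tree from one leaf to the other is the pendant edge.
        pendantEdge i j i≢j u v eᵤ eᵥ with proj₁ isTree u v
        ... | ε     = contradiction (leaf-injective (trans (sym eᵤ) eᵥ)) i≢j
        ... | a ◅ _ = _ , a , pendant i _ (subst (λ x → Adj G x _) eᵤ (preserves a))

        conclude : ∀ {u′ v′} → (u ≡ v × u′ ≡ v′) ⊎ (u ≡ v′ × u′ ≡ v) →
                   map u′ ≡ support i → map v′ ≡ support j → i ≡ j
        conclude (inj₁ (u≡v , _)) _ _  = leaf-injective (trans (sym eᵤ) (trans (cong map u≡v) eᵥ))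
        conclude (inj₂ (u≡v′ , _)) _ e = contradiction
          (trans (sym eᵤ) (trans (cong map u≡v′) e)) (leaf≢support i j)

star-reach : ∀ n x → Reach (K₁, n) zero 1 x
star-reach n zero    = stay start
star-reach n (suc i) = step start _

star-colours : ∀ {n} → 3 ≤ n → ∀ k (c : EdgeColouring (K₁, n) k) → Is3RainbowColouring c → n ≤ k
star-colours {n} 3≤n = pendants≤colours (K₁, n) 3≤n suc (λ _ → zero) F.suc-injective (λ _ _ ())
  λ { i zero _ → refl }

Kʰ-reach : ∀ n x → Reach (Kʰ (suc n)) zero 2 x
Kʰ-reach n x with F.splitAt (suc n) x in eq
... | inj₁ zero    = subst (Reach (Kʰ (suc n)) zero 2) (F.splitAt⁻¹-↑ˡ eq) (stay (stay start))
... | inj₁ (suc j) = stay (step start (subst (KʰAdj (inj₁ zero)) (sym eq) λ ()))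
... | inj₂ zero    = stay (step start (subst (KʰAdj (inj₁ zero)) (sym eq) refl))
... | inj₂ (suc j) = step {x = suc j F.↑ˡ suc n}
  (step start (subst (KʰAdj (inj₁ zero)) (sym (F.splitAt-↑ˡ (suc n) (suc j) (suc n))) λ ()))
  (subst₂ KʰAdj (sym (F.splitAt-↑ˡ (suc n) (suc j) (suc n))) (sym eq) refl)

Kʰ-colours : ∀ {n} → 3 ≤ n → ∀ k (c : EdgeColouring (Kʰ n) k) → Is3RainbowColouring c → n ≤ k
Kʰ-colours {n} 3≤n = pendants≤colours (Kʰ n) 3≤n (n F.↑ʳ_) (F._↑ˡ n)
  (F.↑ʳ-injective n _ _) distinct pendant
  where
  distinct : ∀ i j → n F.↑ʳ i ≢ j F.↑ˡ n
  distinct i j e with () ← trans (sym (F.splitAt-↑ʳ n n i)) (trans (cong (F.splitAt n) e) (F.splitAt-↑ˡ n j n))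

  pendant : ∀ i v → Adj (Kʰ n) (n F.↑ʳ i) v → v ≡ i F.↑ˡ n
  pendant i v a with subst (λ x → KʰAdj x (F.splitAt n v)) (F.splitAt-↑ʳ n n i) a
  ... | b with F.splitAt n v in eq
  ...   | inj₁ j with refl ← b = sym (F.splitAt⁻¹-↑ˡ eq)

-- Cycles

-- Successor modulo `n`, with wrapping as a separate case instead of a remainder, so that its
-- properties follow by cases on equations.
Next : ℕ → ℕ → ℕ → Set
Next n a b = suc a ≡ b ⊎ (suc a ≡ n × b ≡ 0)

Next-functional : ∀ {n a b c} → b < n → c < n → Next n a b → Next n a c → b ≡ c
Next-functional b<n c<n (inj₁ e)          (inj₁ e′)         = trans (sym e) e′
Next-functional b<n c<n (inj₁ refl)       (inj₂ (refl , _)) = contradiction b<n (ℕ.<-irrefl refl)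
Next-functional b<n c<n (inj₂ (refl , _)) (inj₁ refl)       = contradiction c<n (ℕ.<-irrefl refl)
Next-functional b<n c<n (inj₂ (_ , e))    (inj₂ (_ , e′))   = trans e (sym e′)

Next-injective : ∀ {n a b c} → Next n a c → Next n b c → a ≡ b
Next-injective (inj₁ refl)       (inj₁ e)          = sym (ℕ.suc-injective e)
Next-injective (inj₁ refl)       (inj₂ (_ , ()))
Next-injective (inj₂ (_ , refl)) (inj₁ ())
Next-injective (inj₂ (e , _))    (inj₂ (e′ , _))   = ℕ.suc-injective (trans e (sym e′))

Next-irreflexive : ∀ {n a} → 3 ≤ n → ¬ Next n a a
Next-irreflexive 3≤n          (inj₁ e)             = ℕ.1+n≢n e
Next-irreflexive (s≤s (s≤s _)) (inj₂ (() , refl))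

-- For `n = 2` both directions would hold. From 3 on every edge has a single orientation, so edges
-- can be numbered by their first end.
Next-asymmetric : ∀ {n a b} → 3 ≤ n → Next n a b → ¬ Next n b a
Next-asymmetric 3≤n (inj₁ refl) (inj₁ e) = ℕ.m≢1+n+m _ {1} (sym e)
Next-asymmetric (s≤s (s≤s (s≤s _))) (inj₁ refl)       (inj₂ (() , refl))
Next-asymmetric (s≤s (s≤s (s≤s _))) (inj₂ (() , refl)) (inj₁ refl)
Next-asymmetric (s≤s (s≤s _))       (inj₂ (() , refl)) (inj₂ (_ , refl))

Cycle : ∀ n → 3 ≤ n → Graph
Cycle n 3≤n = record
  { order = n
  ; Adj = λ u v → Next n (toℕ u) (toℕ v) ⊎ Next n (toℕ v) (toℕ u)
  ; Adj? = λ u v → next? (toℕ u) (toℕ v) ⊎-dec next? (toℕ v) (toℕ u)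
  ; Adj-sym = swap
  ; Adj-irrefl = λ { refl (inj₁ e) → Next-irreflexive 3≤n e ; refl (inj₂ e) → Next-irreflexive 3≤n e }
  }
  where
  next? : ∀ a b → Dec (Next n a b)
  next? a b = (suc a ℕ.≟ b) ⊎-dec ((suc a ℕ.≟ n) ×-dec (b ℕ.≟ 0))

successor : ∀ {n} (u : Fin n) → ∃[ v ] Next n (toℕ u) (toℕ v)
successor {n} u with suc (toℕ u) ℕ.<? n
... | yes lt = F.fromℕ< lt , inj₁ (sym (F.toℕ-fromℕ< lt))
successor {suc n} u | no ¬lt = zero , inj₂ (ℕ.≤-antisym (F.toℕ<n u) (ℕ.≮⇒≥ ¬lt) , refl)

next : ∀ {n} → Fin n → Fin n
next u = proj₁ (successor u)

next-Next : ∀ {n} (u : Fin n) → Next n (toℕ u) (toℕ (next u))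
next-Next u = proj₂ (successor u)

predecessor : ∀ {n} (u : Fin n) → Σ[ v ∈ Fin n ] Next n (toℕ v) (toℕ u)
predecessor {suc n} zero    = fromℕ n , inj₂ (cong suc (F.toℕ-fromℕ n) , refl)
predecessor {suc n} (suc u) = inject₁ u , inj₁ (cong suc (F.toℕ-inject₁ u))

toℕ-functional : ∀ {n a} {u v : Fin n} → Next n a (toℕ u) → Next n a (toℕ v) → u ≡ v
toℕ-functional {u = u} {v} p q =
  F.toℕ-injective (Next-functional (F.toℕ<n u) (F.toℕ<n v) p q)

iterate : ∀ {n} → Fin n → ℕ → Fin n
iterate v zero    = v
iterate v (suc i) = next (iterate v i)

iterate-< : ∀ {n} (v : Fin n) i → toℕ v + i < n → toℕ (iterate v i) ≡ toℕ v + i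
iterate-< v zero    lt = sym (ℕ.+-identityʳ _)
iterate-< {n} v (suc i) lt
  with next-Next (iterate v i)
     | iterate-< v i (ℕ.<-trans (ℕ.+-monoʳ-< (toℕ v) ℕ.≤-refl) lt)
... | inj₁ e       | e′ = trans (sym e) (trans (cong suc e′) (sym (ℕ.+-suc _ i)))
... | inj₂ (e , _) | e′ = contradiction lt
  (ℕ.<-irrefl (trans (ℕ.+-suc _ i) (trans (cong suc (sym e′)) e)))

iterate-wrap : ∀ {n} (v : Fin n) i j → toℕ v + i ≡ n + j → j < n → toℕ (iterate v i) ≡ j
iterate-wrap {n} v zero    j e lt = contradiction (F.toℕ<n v) (ℕ.≤⇒≯
  (ℕ.≤-trans (ℕ.m≤m+n n j) (ℕ.≤-reflexive (trans (sym e) (ℕ.+-identityʳ _)))))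
iterate-wrap {n} v (suc i) zero e lt
  with next-Next (iterate v i)
     | iterate-< v i (ℕ.≤-reflexive (trans (sym (ℕ.+-suc _ i)) (trans e (ℕ.+-identityʳ n))))
... | inj₂ (_ , e₀) | _  = e₀
... | inj₁ e₁       | e′ = contradiction (F.toℕ<n (next (iterate v i))) (ℕ.<-irrefl
  (trans (sym e₁) (trans (cong suc e′) (trans (sym (ℕ.+-suc _ i)) (trans e (ℕ.+-identityʳ n))))))
iterate-wrap {n} v (suc i) (suc j) e lt
  with next-Next (iterate v i)
     | iterate-wrap v i j (ℕ.suc-injective (trans (sym (ℕ.+-suc _ i)) (trans e (ℕ.+-suc n j))))
         (ℕ.<-trans ℕ.≤-refl lt)
... | inj₁ e₁       | e′ = trans (sym e₁) (cong suc e′)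
... | inj₂ (e₁ , _) | e′ = contradiction lt (ℕ.<-irrefl (trans (cong suc (sym e′)) e₁))

walkTree : ∀ {G} (f : ℕ → Vertex G) → (∀ i → Adj G (f i) (f (suc i))) → ∀ t →
  Σ[ T ∈ Subtree G ] (∀ i → i ≤ t → f i ∈ᵗ T) × order (tree T) ≤ suc t
walkTree f as zero    = singleton (f 0) , (λ { .0 z≤n → zero , refl }) , ℕ.≤-refl
walkTree {G} f as (suc t) with walkTree {G} f as t
... | T , cov , le with insert T (cov t ℕ.≤-refl) (as t)
...   | T′ , T⊆ , new , le′ = T′ , cov′ , ℕ.≤-trans le′ (s≤s le)
  where
  cov′ : ∀ i → i ≤ suc t → f i ∈ᵗ T′
  cov′ i i≤ with ℕ.m≤n⇒m<n∨m≡n i≤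
  ... | inj₁ (s≤s i≤t) = T⊆ (cov i i≤t)
  ... | inj₂ refl      = new

-- Of the four quarters of the cycle one misses S, and the rest of the cycle is a path.
cycle-smallTrees : ∀ M (3≤n : 3 ≤ 4 * suc M) S → Sub.∣ S ∣ ≡ 3 →
  Σ[ T ∈ SteinerTree (Cycle (4 * suc M) 3≤n) S ] size (SteinerTree.tree T) ≤ suc (3 * suc M)
cycle-smallTrees M 3≤n S e with threeElements S e
... | a , b , c , S⊆ with fourth (quarter a) (quarter b) (quarter c)
  where
  quarter : Fin (4 * suc M) → Fin 4
  quarter = F.quotient {4} (suc M)

  fourth : ∀ i j k → ∃[ l ] (l ≢ i × l ≢ j × l ≢ k)
  fourth = toWitness {a? = F.all? λ (i : Fin 4) → F.all? λ (j : Fin 4) → F.all? λ (k : Fin 4) →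
    F.any? λ (l : Fin 4) → ¬? (l F.≟ i) ×-dec ¬? (l F.≟ j) ×-dec ¬? (l F.≟ k)} _
... | q , q≢a , q≢b , q≢c =
  let T , cov , le = walkTree {Cycle n 3≤n} (iterate w) (λ i → inj₁ (next-Next (iterate w i))) (3 * suc M)
      at : ∀ x → q ≢ F.quotient {4} (suc M) x → x ∈ᵗ T
      at x q≢x =
        let i , i≤ , eq = position x _ (F.remainder {4} (suc M) x) (toℕ-quotient x) q≢x
        in  subst (_∈ᵗ T) eq (cov i i≤)
      covers : ∀ {v} → v ∈ a ∷ b ∷ c ∷ [] → v ∈ᵗ T
      covers = λ { (here refl) → at a q≢a ; (there (here refl)) → at b q≢b
                 ; (there (there (here refl))) → at c q≢c }
  in  steinerTree T (covers ∘ S⊆) , ℕ.≤-trans (size≤order T) le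
  where
  m = suc M
  n = 4 * m

  w : Fin n
  w = F.combine q (fromℕ M)

  toℕ-quotient : ∀ x → toℕ x ≡ m * toℕ (F.quotient {4} m x) + toℕ (F.remainder {4} m x)
  toℕ-quotient x = trans (sym (cong toℕ (F.combine-remQuot {4} m x)))
    (F.toℕ-combine (F.quotient {4} m x) (F.remainder {4} m x))

  toℕ-w : suc (toℕ w) ≡ m * suc (toℕ q)
  toℕ-w = begin
    suc (toℕ w)                        ≡⟨ cong suc (F.toℕ-combine q (fromℕ M)) ⟩
    suc (m * toℕ q + toℕ (fromℕ M))    ≡⟨ cong (λ z → suc (m * toℕ q + z)) (F.toℕ-fromℕ M) ⟩
    suc (m * toℕ q + M)                ≡⟨ ℕ.+-suc (m * toℕ q) M ⟨
    m * toℕ q + m                      ≡⟨ ℕ.+-comm (m * toℕ q) m ⟩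
    m + m * toℕ q                      ≡⟨ ℕ.*-suc m (toℕ q) ⟨
    m * suc (toℕ q)                    ∎
    where open ≡-Reasoning

  position : ∀ x (p : Fin 4) (j : Fin m) → toℕ x ≡ m * toℕ p + toℕ j → q ≢ p →
             ∃[ i ] i ≤ 3 * m × iterate w i ≡ x
  position x p j eq q≢p with ℕ.<-cmp (toℕ q) (toℕ p)
  ... | tri≈ _ e _   = contradiction (F.toℕ-injective e) q≢p
  ... | tri< q<p _ _ = toℕ x ∸ toℕ w , i≤ ,
          F.toℕ-injective (trans (iterate-< w _ (subst (_< n) (sym w+i≡x) (F.toℕ<n x))) w+i≡x)
    where
    w<x : toℕ w < toℕ x
    w<x = begin
      suc (toℕ w)      ≡⟨ toℕ-w ⟩
      m * suc (toℕ q)  ≤⟨ ℕ.*-monoʳ-≤ m q<p ⟩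
      m * toℕ p        ≤⟨ ℕ.m≤m+n _ (toℕ j) ⟩
      m * toℕ p + toℕ j ≡⟨ eq ⟨
      toℕ x ∎
      where open ℕ.≤-Reasoning

    w+i≡x : toℕ w + (toℕ x ∸ toℕ w) ≡ toℕ x
    w+i≡x = ℕ.m+[n∸m]≡n (ℕ.<⇒≤ w<x)

    i≤ : toℕ x ∸ toℕ w ≤ 3 * m
    i≤ = ℕ.m≤n+o⇒m∸n≤o (toℕ x) (toℕ w) (s≤s⁻¹ (begin
      suc (toℕ x)           ≤⟨ F.toℕ<n x ⟩
      m + 3 * m             ≤⟨ ℕ.+-monoˡ-≤ (3 * m) (ℕ.m≤m*n m (suc (toℕ q))) ⟩
      m * suc (toℕ q) + 3 * m ≡⟨ cong (_+ 3 * m) toℕ-w ⟨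
      suc (toℕ w) + 3 * m   ∎))
      where open ℕ.≤-Reasoning
  -- A quarter before `q` is reached only after passing 0, hence the extra `n`.
  ... | tri> _ _ p<q = n + toℕ x ∸ toℕ w , i≤ , F.toℕ-injective (iterate-wrap w _ (toℕ x)
          (ℕ.m+[n∸m]≡n (ℕ.≤-trans (ℕ.<⇒≤ (F.toℕ<n w)) (ℕ.m≤m+n n (toℕ x)))) (F.toℕ<n x))
    where
    x<mq : suc (toℕ x) ≤ m * toℕ q
    x<mq = begin
      suc (toℕ x)             ≡⟨ cong suc eq ⟩
      suc (m * toℕ p + toℕ j) ≡⟨ ℕ.+-suc _ _ ⟨
      m * toℕ p + suc (toℕ j) ≤⟨ ℕ.+-monoʳ-≤ (m * toℕ p) (F.toℕ<n j) ⟩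
      m * toℕ p + m           ≡⟨ ℕ.+-comm (m * toℕ p) m ⟩
      m + m * toℕ p           ≡⟨ ℕ.*-suc m (toℕ p) ⟨
      m * suc (toℕ p)         ≤⟨ ℕ.*-monoʳ-≤ m p<q ⟩
      m * toℕ q ∎
      where open ℕ.≤-Reasoning

    i≤ : n + toℕ x ∸ toℕ w ≤ 3 * m
    i≤ = ℕ.m≤n+o⇒m∸n≤o (n + toℕ x) (toℕ w) (s≤s⁻¹ (begin
      suc (n + toℕ x)           ≡⟨ ℕ.+-suc n (toℕ x) ⟨
      n + suc (toℕ x)           ≤⟨ ℕ.+-monoʳ-≤ n x<mq ⟩
      m + 3 * m + m * toℕ q     ≡⟨ cong (_+ m * toℕ q) (ℕ.+-comm m (3 * m)) ⟩
      3 * m + m + m * toℕ q     ≡⟨ ℕ.+-assoc (3 * m) m (m * toℕ q) ⟩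
      3 * m + (m + m * toℕ q)   ≡⟨ cong (3 * m +_) (ℕ.*-suc m (toℕ q)) ⟨
      3 * m + m * suc (toℕ q)   ≡⟨ cong (3 * m +_) toℕ-w ⟨
      3 * m + suc (toℕ w)       ≡⟨ ℕ.+-comm (3 * m) _ ⟩
      suc (toℕ w) + 3 * m       ∎))
      where open ℕ.≤-Reasoning

cycle-connected : ∀ {n} (3≤n : 3 ≤ n) → Connected (Cycle n 3≤n)
cycle-connected {suc n} 3≤n = reach⇒connected {n = n} reach
  where
  G = Cycle (suc n) 3≤n

  walk : ∀ i → Reach G zero i (iterate zero i)
  walk zero    = start
  walk (suc i) = step (walk i) (inj₁ (next-Next (iterate zero i)))

  reach : ∀ x → Reach G zero n x
  reach x = reach-mono (s≤s⁻¹ (F.toℕ<n x))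
    (subst (Reach G zero (toℕ x)) (F.toℕ-injective (iterate-< zero (toℕ x) (F.toℕ<n x))) (walk (toℕ x)))

-- Lower bound for rainbow colourings of cycles

module _ {n} (3≤n : 3 ≤ n) {k} (c : EdgeColouring (Cycle n 3≤n) k)
         (rainbow₃ : Is3RainbowColouring c) where

  private
    G = Cycle n 3≤n

    edgeColour : Fin n → Fin k
    edgeColour i = colour c i (next i)

    -- A record, so that `Q` can be inferred from the type of a proof; `Q` speaks of numbers, so
    -- that arcs can be given by inequalities.
    record InjectiveOn (Q : ℕ → Set) : Set where
      constructor injectiveOn
      field
        on : ∀ i j → Q (toℕ i) → Q (toℕ j) → edgeColour i ≡ edgeColour j → i ≡ j

    open InjectiveOn

    weaken : ∀ {Q R : ℕ → Set} → (∀ {i} → R i → Q i) → InjectiveOn Q → InjectiveOn R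
    weaken R⊆Q inj = injectiveOn λ i j r r′ → on inj i j (R⊆Q r) (R⊆Q r′)

  -- A tree containing the vertices 0 < x < y misses edges of at most one of the three
  -- arcs they cut the cycle into.
  module _ {x y} (0<x : 0 < x) (x<y : x < y) (y<n : y < n) where

    private
      x<n = ℕ.<-trans x<y y<n
      0<n = ℕ.<-trans 0<x x<n

      v₀ vₓ vᵧ : Fin n
      v₀ = F.fromℕ< 0<n
      vₓ = F.fromℕ< x<n
      vᵧ = F.fromℕ< y<n

      ≢-by : ∀ {a b} (p : a < n) (q : b < n) → a < b → F.fromℕ< p ≢ F.fromℕ< q
      ≢-by p q a<b e = ℕ.<⇒≢ a<b (trans (sym (F.toℕ-fromℕ< p)) (trans (cong toℕ e) (F.toℕ-fromℕ< q)))

    module _ {S} (T : SteinerTree G S) (rb : Rainbow c T)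
             (∈₀ : v₀ Sub.∈ S) (∈ₓ : vₓ Sub.∈ S) (∈ᵧ : vᵧ Sub.∈ S) where

      open SteinerTree T using (map; preserves; isTree; covers) renaming (tree to H)

      private
        InTree : Fin n → Set
        InTree i = ∃[ s ] ∃[ t ] map s ≡ i × map t ≡ next i × Adj H s t

        InTree? : ∀ i → Dec (InTree i)
        InTree? i = F.any? λ s → F.any? λ t → (map s F.≟ i) ×-dec (map t F.≟ next i) ×-dec Adj? H s t

        tree-injective : ∀ {i j} → InTree i → InTree j → edgeColour i ≡ edgeColour j → i ≡ j
        tree-injective {i} {j} (s , t , eₛ , eₜ , a) (s′ , t′ , eₛ′ , eₜ′ , a′) e
          with rb a a′ (trans (cong₂ (colour c) eₛ eₜ)
                 (trans e (sym (cong₂ (colour c) eₛ′ eₜ′))))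
        ... | inj₁ (s≡s′ , _) = trans (sym eₛ) (trans (cong map s≡s′) eₛ′)
        ... | inj₂ (s≡t′ , t≡s′) = contradiction
          (subst (λ z → Next n (toℕ i) (toℕ z)) (trans (sym eₜ) (trans (cong map t≡s′) eₛ′)) (next-Next i))
          (Next-asymmetric 3≤n
            (subst (λ z → Next n (toℕ j) (toℕ z)) (trans (sym eₜ′) (trans (cong map (sym s≡t′)) eₛ)) (next-Next j)))

        full⇒injective : ∀ {Q : ℕ → Set} → (∀ i → Q (toℕ i) → InTree i) → InjectiveOn Q
        full⇒injective full = injectiveOn λ i j qᵢ qⱼ → tree-injective (full i qᵢ) (full j qⱼ)

        full-or-missing : ∀ {Q : ℕ → Set} → (∀ i → Dec (Q i)) →
          (∀ i → Q (toℕ i) → InTree i) ⊎ ∃[ i ] Q (toℕ i) × ¬ InTree i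
        full-or-missing Q? with F.any? (λ i → Q? (toℕ i) ×-dec ¬? (InTree? i))
        ... | yes p = inj₂ p
        ... | no ¬p = inj₁ full
          where
          full : ∀ i → _ → InTree i
          full i q with InTree? i
          ... | yes p = p
          ... | no ¬t = contradiction (i , q , ¬t) ¬p

        module _ {e f : Fin n} (¬e : ¬ InTree e) (¬f : ¬ InTree f) where

          -- For `e` before `f`, removing these two edges cuts the cycle in two; this is the part
          -- without 0.
          Between : Fin n → Set
          Between v = toℕ e < toℕ v × toℕ v ≤ toℕ f

          edge-in-tree : ∀ {s t} → Adj H s t → Next n (toℕ (map s)) (toℕ (map t)) → InTree (map s)
          edge-in-tree {s} {t} a p = s , t , refl , toℕ-functional p (next-Next (map s)) , a

          -- The part can be left only forwards across `f` or backwards across `e`, and the tree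
          -- contains neither edge.
          between-closed : ∀ {s t} → Adj H s t → Between (map s) → Between (map t)
          between-closed {s} {t} a (e<s , s≤f) with preserves a
          ... | inj₁ p = forward p
            where
            s<f : toℕ (map s) < toℕ f
            s<f = ℕ.≤∧≢⇒< s≤f λ eq → ¬f (subst InTree (F.toℕ-injective eq) (edge-in-tree a p))

            forward : Next n (toℕ (map s)) (toℕ (map t)) → Between (map t)
            forward (inj₁ eq) =
              subst (toℕ e <_) eq (ℕ.<-trans e<s ℕ.≤-refl) , subst (_≤ toℕ f) eq s<f
            forward (inj₂ (eq , _)) = contradiction
              (ℕ.<-≤-trans (F.toℕ<n f) (ℕ.≤-trans (ℕ.≤-reflexive (sym eq)) s<f)) (ℕ.<-irrefl refl)
          ... | inj₂ p = backward p
            where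
            e≢t : toℕ e ≢ toℕ (map t)
            e≢t eq = ¬e (subst InTree (F.toℕ-injective (sym eq)) (edge-in-tree (Adj-sym H a) p))

            backward : Next n (toℕ (map t)) (toℕ (map s)) → Between (map t)
            backward (inj₁ eq) = ℕ.≤∧≢⇒< (s≤s⁻¹ (subst (toℕ e <_) (sym eq) e<s)) e≢t ,
              ℕ.≤-trans (ℕ.n≤1+n _) (subst (_≤ toℕ f) (sym eq) s≤f)
            backward (inj₂ (_ , eq)) with () ← subst (toℕ e <_) eq e<s

          between-star : ∀ {s t} → Star (Adj H) s t → Between (map s) → Between (map t)
          between-star ε        b = b
          between-star (a ◅ as) b = between-star as (between-closed a b)

          not-separated : ∀ {u v} → u Sub.∈ S → v Sub.∈ S → Between u → Between v
          not-separated u∈ v∈ b with covers u∈ | covers v∈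
          ... | s , refl | t , refl = between-star (proj₁ isTree s t) b

        ¬0 : ∀ {e f} → toℕ e < toℕ v₀ × toℕ v₀ ≤ toℕ {n} f → ⊥
        ¬0 {e} (lt , _) with () ← subst (toℕ {n} e <_) (F.toℕ-fromℕ< 0<n) lt

        toℕₓ = F.toℕ-fromℕ< x<n
        toℕᵧ = F.toℕ-fromℕ< y<n

      arcs : InjectiveOn (x ≤_) ⊎ InjectiveOn (λ i → i < x ⊎ y ≤ i) ⊎ InjectiveOn (_< y)
      arcs with full-or-missing (ℕ._<? x)
              | full-or-missing (λ i → (x ℕ.≤? i) ×-dec (i ℕ.<? y))
              | full-or-missing (y ℕ.≤?_)
      -- When two arcs both miss an edge, `x` or `y` lies between the missing edges and 0 does not,
      -- so the tree would be disconnected.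
      ... | inj₂ (e , e<x , ¬e) | inj₂ (f , (x≤f , _) , ¬f) | _ =
        ⊥-elim (¬0 {e} {f} (not-separated ¬e ¬f ∈ₓ ∈₀
          (subst (toℕ e <_) (sym toℕₓ) e<x , subst (_≤ toℕ f) (sym toℕₓ) x≤f)))
      ... | inj₂ (e , e<x , ¬e) | inj₁ _ | inj₂ (f , y≤f , ¬f) =
        ⊥-elim (¬0 {e} {f} (not-separated ¬e ¬f ∈ₓ ∈₀
          (subst (toℕ e <_) (sym toℕₓ) e<x ,
           subst (_≤ toℕ f) (sym toℕₓ) (ℕ.≤-trans (ℕ.<⇒≤ x<y) y≤f))))
      ... | inj₁ _ | inj₂ (e , (_ , e<y) , ¬e) | inj₂ (f , y≤f , ¬f) =
        ⊥-elim (¬0 {e} {f} (not-separated ¬e ¬f ∈ᵧ ∈₀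
          (subst (toℕ e <_) (sym toℕᵧ) e<y , subst (_≤ toℕ f) (sym toℕᵧ) y≤f)))
      ... | inj₁ full₁ | inj₁ full₂ | _ = inj₂ (inj₂ (full⇒injective full))
        where
        full : ∀ i → toℕ i < y → InTree i
        full i i<y with toℕ i ℕ.<? x
        ... | yes i<x = full₁ i i<x
        ... | no  i≮x = full₂ i (ℕ.≮⇒≥ i≮x , i<y)
      ... | inj₁ full₁ | inj₂ _ | inj₁ full₃ = inj₂ (inj₁ (full⇒injective
        λ { i (inj₁ i<x) → full₁ i i<x ; i (inj₂ y≤i) → full₃ i y≤i }))
      ... | inj₂ _ | inj₁ full₂ | inj₁ full₃ = inj₁ (full⇒injective full)
        where
        full : ∀ i → x ≤ toℕ i → InTree i
        full i x≤i with toℕ i ℕ.<? y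
        ... | yes i<y = full₂ i (x≤i , i<y)
        ... | no  i≮y = full₃ i (ℕ.≮⇒≥ i≮y)

    rainbow-arcs : InjectiveOn (x ≤_) ⊎ InjectiveOn (λ i → i < x ⊎ y ≤ i) ⊎ InjectiveOn (_< y)
    rainbow-arcs =
      let S , ∣S∣≡3 , ∈₀ , ∈ₓ , ∈ᵧ = triple v₀ vₓ vᵧ
            (≢-by 0<n x<n 0<x) (≢-by 0<n y<n (ℕ.<-trans 0<x x<y)) (≢-by x<n y<n x<y)
          T , rb = rainbow₃ S ∣S∣≡3
      in  arcs T rb ∈₀ ∈ₓ ∈ᵧ

  private
    injective-prefix≤ : ∀ {t} → t ≤ n → InjectiveOn (_< t) → t ≤ k
    injective-prefix≤ {t} t≤n inj = F.injective⇒≤ {f = λ i → edgeColour (F.inject≤ i t≤n)} λ {i} {j} e →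
      F.inject≤-injective t≤n t≤n i j (on inj _ _ (below i) (below j) e)
      where
      below : ∀ i → toℕ (F.inject≤ i t≤n) < t
      below i = subst (_< t) (sym (F.toℕ-inject≤ i t≤n)) (F.toℕ<n i)

    injective-off-two : ∀ {m} → n ≡ suc (suc m) → (t u : Fin n) → t ≢ u →
                        InjectiveOn (λ i → i ≢ toℕ t × i ≢ toℕ u) → m ≤ k
    injective-off-two {m} refl t u t≢u inj = F.injective⇒≤ {f = edgeColour ∘ skip} λ {i} {j} e →
      F.punchIn-injective u′ i j (F.punchIn-injective t _ _
        (on inj (skip i) (skip j) (avoids i) (avoids j) e))
      where
      u′ : Fin (suc m)
      u′ = F.punchOut t≢u

      skip : Fin m → Fin (suc (suc m))
      skip i = F.punchIn t (F.punchIn u′ i)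

      avoids : ∀ i → toℕ (skip i) ≢ toℕ t × toℕ (skip i) ≢ toℕ u
      avoids i = (λ e → F.punchInᵢ≢i t _ (F.toℕ-injective e)) ,
        λ e → F.punchInᵢ≢i u′ i (F.punchIn-injective t _ _
          (trans (F.toℕ-injective e) (sym (F.punchIn-punchOut t≢u))))

  -- Let t be least such that the edges 0, …, t are not rainbow; then t+1, …, n-1 are. Let u
  -- be least such that 0, …, u and t+1, …, n-1 are not rainbow together; then u+1, …, n-1
  -- are. So all edges but t and u have distinct colours. The goal being ⊥, the least
  -- elements are found without deciding anything.
  ¬few-colours : ¬ (3 + k ≤ n)
  ¬few-colours few = ¬¬prefix n ℕ.≤-refl λ inj →
    ℕ.<-irrefl refl (ℕ.≤-trans (ℕ.≤-trans (ℕ.m≤n+m (suc k) 2) few) (injective-prefix≤ ℕ.≤-refl inj))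
    where
    ¬¬prefix : ∀ t → t ≤ n → ¬ ¬ InjectiveOn (_< t)
    ¬¬prefix zero    _   ¬inj = ¬inj (injectiveOn λ _ _ ())
    ¬¬prefix (suc t) t<n ¬inj = ¬¬prefix t (ℕ.<⇒≤ t<n) λ prefix →
      -- A rainbow prefix of length `t` shows `t` distinct colours, so `3 + t ≤ n` and the vertex
      -- `t + 2` used as a cut exists.
      let t≤k = injective-prefix≤ (ℕ.<⇒≤ t<n) prefix
      in  repeat prefix (ℕ.≤-trans (ℕ.+-monoʳ-≤ 3 t≤k) few)
      where
      module _ (prefix : InjectiveOn (_< t)) (t+2<n : suc (suc t) < n) where

        suffix : InjectiveOn (suc t ≤_)
        -- With cuts at `t + 1` and `t + 2`, each of the last two alternatives covers the edges 0,
        -- ..., t and contradicts `¬inj`.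
        suffix with rainbow-arcs {suc t} {suc (suc t)} (s≤s z≤n) ℕ.≤-refl t+2<n
        ... | inj₁ inj        = inj
        ... | inj₂ (inj₁ inj) = contradiction (weaken inj₁ inj) ¬inj
        ... | inj₂ (inj₂ inj) = contradiction (weaken (λ lt → ℕ.<-trans lt ℕ.≤-refl) inj) ¬inj

        t′ : Fin n
        t′ = F.fromℕ< t<n

        ¬off-two : ∀ {u} → u < n → u ≢ t → ¬ InjectiveOn (λ i → i ≢ t × i ≢ u)
        ¬off-two {u} u<n u≢t inj = ℕ.<-irrefl refl (ℕ.≤-trans
          (ℕ.∸-monoˡ-≤ 2 few) (injective-off-two
            (sym (ℕ.m+[n∸m]≡n (ℕ.≤-trans (s≤s (s≤s z≤n)) few))) t′ (F.fromℕ< u<n)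
            (λ e → u≢t (trans (sym (F.toℕ-fromℕ< u<n)) (trans (cong toℕ (sym e)) (F.toℕ-fromℕ< t<n))))
            (weaken (λ (p , q) → (λ e → p (trans e (sym (F.toℕ-fromℕ< t<n)))) ,
                                 (λ e → q (trans e (sym (F.toℕ-fromℕ< u<n))))) inj)))

        ¬¬both : ∀ u → u ≤ t → ¬ ¬ InjectiveOn (λ i → i < u ⊎ suc t ≤ i)
        ¬¬both zero    _   ¬both = ¬both (weaken (λ { (inj₂ p) → p }) suffix)
        ¬¬both (suc u) u<t ¬both = ¬¬both u (ℕ.<⇒≤ u<t) λ both →
          off-two both (rainbow-arcs {suc u} {suc t} (s≤s z≤n) (s≤s u<t) (ℕ.<-trans ℕ.≤-refl t+2<n))
          where
          off-two : InjectiveOn (λ i → i < u ⊎ suc t ≤ i) →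
            InjectiveOn (suc u ≤_) ⊎ InjectiveOn (λ i → i < suc u ⊎ suc t ≤ i) ⊎ InjectiveOn (_< suc t) → ⊥
          off-two both (inj₂ (inj₁ inj)) = ¬both inj
          off-two both (inj₂ (inj₂ inj)) = ¬inj inj
          off-two both (inj₁ after) = ¬off-two (ℕ.<-trans u<t t<n) (ℕ.<⇒≢ u<t) (injectiveOn inj)
            where
            -- Two edges other than `t` and `u` both precede `t`, both follow `u`, or lie one before
            -- `u` and one after `t`; these are the ranges of `prefix`, `after` and `both`.
            inj : ∀ i j → toℕ i ≢ t × toℕ i ≢ u → toℕ j ≢ t × toℕ j ≢ u →
                  edgeColour i ≡ edgeColour j → i ≡ j
            inj i j (i≢t , i≢u) (j≢t , j≢u)
              with ℕ.<-cmp (toℕ i) u | ℕ.<-cmp (toℕ j) u | ℕ.<-cmp (toℕ i) t | ℕ.<-cmp (toℕ j) t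
            ... | tri≈ _ e _ | _          | _          | _          = contradiction e i≢u
            ... | _          | tri≈ _ e _ | _          | _          = contradiction e j≢u
            ... | _          | _          | tri≈ _ e _ | _          = contradiction e i≢t
            ... | _          | _          | _          | tri≈ _ e _ = contradiction e j≢t
            ... | _          | _          | tri< p _ _ | tri< q _ _ = on prefix i j p q
            ... | tri> _ _ p | tri> _ _ q | _          | _          = on after i j p q
            ... | _          | _          | tri> _ _ p | tri> _ _ q = on both i j (inj₂ p) (inj₂ q)
            ... | tri< p _ _ | _          | _          | tri> _ _ q = on both i j (inj₁ p) (inj₂ q)
            ... | _          | tri< q _ _ | tri> _ _ p | _          = on both i j (inj₂ p) (inj₁ q)
            ... | tri> _ _ p | tri< q _ _ | tri< p′ _ _ | tri> _ _ q′ =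
              contradiction (ℕ.<-trans q u<t) (ℕ.<⇒≯ q′)
            ... | tri< q _ _ | tri> _ _ p | tri> _ _ q′ | tri< p′ _ _ =
              contradiction (ℕ.<-trans q u<t) (ℕ.<⇒≯ q′)

        repeat : ⊥
        -- If no `u` fails, all edges but `t` have distinct colours already; `t + 1` is an arbitrary
        -- second edge to leave out.
        repeat = ¬¬both t ℕ.≤-refl λ both → ¬off-two (ℕ.<-trans ℕ.≤-refl t+2<n) ℕ.1+n≢n
          (weaken (λ {i} (i≢t , _) → side i i≢t) both)
          where
          side : ∀ i → i ≢ t → i < t ⊎ suc t ≤ i
          side i i≢t with ℕ.<-cmp i t
          ... | tri< p _ _ = inj₁ p
          ... | tri≈ _ e _ = contradiction e i≢t
          ... | tri> _ _ p = inj₂ p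

cycle-colours : ∀ {n} (3≤n : 3 ≤ n) k (c : EdgeColouring (Cycle n 3≤n) k) → Is3RainbowColouring c → n ∸ 2 ≤ k
cycle-colours {n} 3≤n k c rainbow₃ = ℕ.m≤n+o⇒m∸n≤o n 2 (s≤s⁻¹ (ℕ.≰⇒> (¬few-colours 3≤n c rainbow₃)))

-- Induced subgraphs of stars and cycles

≅-trans : ∀ {G H K} → G ≅ H → H ≅ K → G ≅ K
≅-trans {G} {H} {K} = Setoid.trans ≅-setoid {G} {H} {K}

≅-sym : ∀ {G H} → G ≅ H → H ≅ G
≅-sym {G} {H} = Setoid.sym ≅-setoid {G} {H}

surjective⇒≅ : ∀ {H G} ((f , _) : H ⊑ᵢ G) → (∀ v → ∃[ u ] f u ≡ v) → H ≅ G
surjective⇒≅ (f , f-inj , p) sur =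
  mk↔ₛ′ f (proj₁ ∘ sur) (proj₂ ∘ sur) (λ u → f-inj (proj₂ (sur (f u)))) , p

unhit-vertex : ∀ {m n} (f : Fin m → Fin n) → m < n → ∃[ v ] (∀ u → f u ≢ v)
unhit-vertex {m} {n} f m<n with F.any? (λ v → F.all? (λ u → ¬? (f u F.≟ v)))
... | yes p = p
... | no ¬p = contradiction (F.injective⇒≤ {f = proj₁ ∘ hit}
    (λ {v} {w} e → trans (sym (proj₂ (hit v))) (trans (cong f e) (proj₂ (hit w))))) (ℕ.<⇒≱ m<n)
  where
  hit : ∀ v → ∃[ u ] f u ≡ v
  hit v with F.any? (λ u → f u F.≟ v)
  ... | yes q = q
  ... | no ¬q = contradiction (v , λ u e → ¬q (u , e)) ¬p

some-edge : ∀ {G} → Connected G → 2 ≤ order G → ∃[ u ] ∃[ v ] Adj G u v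
some-edge {G} conn 2≤n = first (conn _ _) (λ e → contradiction
  (F.inject≤-injective 2≤n 2≤n zero (suc zero) e) λ ())
  where
  first : ∀ {u v} → Star (Adj G) u v → u ≢ v → ∃[ u ] ∃[ v ] Adj G u v
  first ε       u≢u = contradiction refl u≢u
  first (a ◅ _) _   = _ , _ , a

-- Connectedness provides an edge, and one of its ends must be mapped to the centre; the remaining
-- vertices are then leaves around that end.
star-subgraph : ∀ {H n} → Connected H → 2 ≤ order H → H ⊑ᵢ (K₁, n) → ∃[ r ] H ≅ (K₁, r)
star-subgraph {H} {n} conn 2≤ (f , f-inj , p) =
  let u , v , a = some-edge {H} conn 2≤
      c , fc≡0 = centre u v (Equivalence.to (p u v) a)
  in  length (others c) , ≅-sym {K₁, _} {H} (star≅ c fc≡0)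
  where
  others : Vertex H → List (Vertex H)
  others c = filter (λ v → ¬? (v F.≟ c)) (allFin (order H))

  centre : ∀ u v → Adj (K₁, n) (f u) (f v) → ∃[ c ] f c ≡ zero
  centre u v a with f u in eᵤ | f v in eᵥ
  ... | zero  | _    = u , eᵤ
  ... | suc _ | zero = v , eᵥ

  module _ (c : Vertex H) (fc≡0 : f c ≡ zero) where

    leaf : ∀ {v} → v ≢ c → ∃[ i ] f v ≡ suc i
    leaf {v} v≢c with f v in eq
    ... | zero  = contradiction (f-inj (trans eq (sym fc≡0))) v≢c
    ... | suc i = i , refl

    adjacent : ∀ {v} → v ≢ c → Adj H c v
    adjacent v≢c = Equivalence.from (p c _)
      (subst₂ (Adj (K₁, n)) (sym fc≡0) (sym (proj₂ (leaf v≢c))) _)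

    nonadjacent : ∀ {v w} → v ≢ c → w ≢ c → ¬ Adj H v w
    nonadjacent v≢c w≢c a =
      subst₂ (Adj (K₁, n)) (proj₂ (leaf v≢c)) (proj₂ (leaf w≢c)) (Equivalence.to (p _ _) a)

    all-others : All (_≢ c) (others c)
    all-others = All.all-filter (λ v → ¬? (v F.≟ c)) (allFin (order H))

    independent : ∀ {xs} → All (_≢ c) xs → AllPairs _≢_ xs → AllPairs (Indep H) xs
    independent []       []       = []
    independent (q ∷ qs) (r ∷ rs) =
      All.zipWith (λ (v≢w , w≢c) → v≢w , nonadjacent q w≢c) (r , qs) ∷ independent qs rs

    star≅ : (K₁, length (others c)) ≅ H
    star≅ = surjective⇒≅ {K₁, _} {H} (star-embedding H c (others c)
        (All.map adjacent all-others)
        (independent all-others (Unique.filter⁺ (λ v → ¬? (v F.≟ c)) (Unique.allFin⁺ _))))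
      hit
      where
      hit : ∀ v → _
      hit v with v F.≟ c
      ... | yes v≡c = zero , sym v≡c
      ... | no  v≢c =
        let v∈ = ∈-filter⁺ (λ v → ¬? (v F.≟ c)) (∈-allFin v) v≢c
        in  suc (Any.index v∈) , sym (lookup-index v∈)

P-shift : ∀ {H m n} ((f , _) : H ⊑ᵢ P n) (g : Vertex H → Fin m) d →
          (∀ v → d + toℕ (g v) ≡ toℕ (f v)) → H ⊑ᵢ P m
P-shift {H} (f , f-inj , p) g d eq =
  g , (λ {u} {v} e → f-inj (F.toℕ-injective (trans (sym (eq u)) (trans (cong (λ z → d + toℕ z) e) (eq v))))) ,
  λ u v → mk⇔ (λ a → lower (subst₂ Consecutive (sym (eq u)) (sym (eq v)) (Equivalence.to (p u v) a)))
              (λ a → Equivalence.from (p u v) (subst₂ Consecutive (eq u) (eq v) (raise a)))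
  where
  lower : ∀ {a b} → Consecutive (d + a) (d + b) → Consecutive a b
  lower {a} {b} (inj₁ e) = inj₁ (ℕ.+-cancelˡ-≡ d _ _ (trans (ℕ.+-suc d a) e))
  lower {a} {b} (inj₂ e) = inj₂ (ℕ.+-cancelˡ-≡ d _ _ (trans (ℕ.+-suc d b) e))

  raise : ∀ {a b} → Consecutive a b → Consecutive (d + a) (d + b)
  raise (inj₁ refl) = inj₁ (sym (ℕ.+-suc d _))
  raise (inj₂ refl) = inj₂ (sym (ℕ.+-suc d _))

-- The host path is shortened at an end that is not hit. Once both ends are hit, a missed vertex in
-- between would separate their preimages in the connected `H`.
path-subgraph : ∀ {H} → Connected H → 1 ≤ order H → ∀ n → H ⊑ᵢ P n → ∃[ ℓ ] H ≅ P ℓ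
path-subgraph conn 1≤ zero    (f , _) = contradiction (f (F.inject≤ zero 1≤)) λ ()
path-subgraph {H} conn 1≤ (suc n) ι@(f , f-inj , p)
  with F.any? (λ v → f v F.≟ zero) | F.any? (λ v → f v F.≟ fromℕ n)
... | no ¬bottom | _ = path-subgraph {H} conn 1≤ n (P-shift {H} ι (proj₁ ∘ drop) 1 (proj₂ ∘ drop))
  where
  drop : ∀ v → ∃[ i ] suc (toℕ i) ≡ toℕ (f v)
  drop v with f v in eq
  ... | zero  = contradiction (v , eq) ¬bottom
  ... | suc i = i , refl
... | yes _ | no ¬top = path-subgraph {H} conn 1≤ n
    (P-shift {H} ι (λ v → F.lower₁ (f v) (below v)) 0 (λ v → F.toℕ-lower₁ (f v) (below v)))
  where
  below : ∀ v → n ≢ toℕ (f v)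
  below v e = ¬top (v , F.toℕ-injective (trans (sym e) (sym (F.toℕ-fromℕ n))))
... | yes (b , fb≡0) | yes (t , ft≡n) = suc n , surjective⇒≅ {H} {P (suc n)} ι hit
  where
  hit : ∀ m → ∃[ v ] f v ≡ m
  hit m with F.any? (λ v → f v F.≟ m)
  ... | yes q = q
  ... | no ¬q = contradiction (stays-below (conn b t) bottom<m) (ℕ.≤⇒≯ m≤top)
    where
    f≢m : ∀ v → toℕ (f v) ≢ toℕ m
    f≢m v e = ¬q (v , F.toℕ-injective e)

    step-below : ∀ {u v} → Adj H u v → toℕ (f u) < toℕ m → toℕ (f v) < toℕ m
    step-below {u} {v} a lt with Equivalence.to (p u v) a
    ... | inj₁ e = ℕ.≤∧≢⇒< (ℕ.≤-trans (ℕ.≤-reflexive (sym e)) lt) (f≢m v)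
    ... | inj₂ e = ℕ.<-trans (ℕ.≤-reflexive e) lt

    stays-below : ∀ {u v} → Star (Adj H) u v → toℕ (f u) < toℕ m → toℕ (f v) < toℕ m
    stays-below ε        lt = lt
    stays-below (a ◅ as) lt = stays-below as (step-below a lt)

    bottom<m : toℕ (f b) < toℕ m
    bottom<m = ℕ.≤∧≢⇒< (subst (_≤ toℕ m) (sym (cong toℕ fb≡0)) z≤n) (f≢m b)

    m≤top : toℕ m ≤ toℕ (f t)
    m≤top = ℕ.≤-trans (s≤s⁻¹ (F.toℕ<n m)) (ℕ.≤-reflexive (sym (trans (cong toℕ ft≡n) (F.toℕ-fromℕ n))))

-- Repeated, it brings a missed vertex to 0, so that only the cycle without 0 has to be recognised
-- as a path.
rotation : ∀ {n} (3≤n : 3 ≤ n) → Cycle n 3≤n ⊑ᵢ Cycle n 3≤n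
rotation {n} 3≤n = rot , rot-inj , λ u v → mk⇔ (to u v) (from u v)
  where
  G = Cycle n 3≤n

  rot : Fin n → Fin n
  rot u = proj₁ (predecessor u)

  rot-Next : ∀ u → Next n (toℕ (rot u)) (toℕ u)
  rot-Next u = proj₂ (predecessor u)

  rot-inj : ∀ {u v} → rot u ≡ rot v → u ≡ v
  rot-inj {u} {v} e = toℕ-functional (rot-Next u) (subst (λ z → Next n (toℕ z) (toℕ v)) (sym e) (rot-Next v))

  Next-to : ∀ u v → Next n (toℕ u) (toℕ v) → Next n (toℕ (rot u)) (toℕ (rot v))
  Next-to u v q = subst (Next n (toℕ (rot u))) (Next-injective q (rot-Next v)) (rot-Next u)

  Next-from : ∀ u v → Next n (toℕ (rot u)) (toℕ (rot v)) → Next n (toℕ u) (toℕ v)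
  Next-from u v q = subst (λ z → Next n (toℕ z) (toℕ v)) (toℕ-functional q (rot-Next u)) (rot-Next v)

  to : ∀ u v → Adj G u v → Adj G (rot u) (rot v)
  to u v (inj₁ q) = inj₁ (Next-to u v q)
  to u v (inj₂ q) = inj₂ (Next-to v u q)

  from : ∀ u v → Adj G (rot u) (rot v) → Adj G u v
  from u v (inj₁ q) = inj₁ (Next-from u v q)
  from u v (inj₂ q) = inj₂ (Next-from v u q)

cycle-subgraph : ∀ {H n} (3≤n : 3 ≤ n) → order H < n → H ⊑ᵢ Cycle n 3≤n → ∃[ m ] H ⊑ᵢ P m
cycle-subgraph {H} {n} 3≤n lt ι = let v , v∉ = unhit-vertex (proj₁ ι) lt in go {3≤n = 3≤n} (toℕ v) v refl ι v∉
  where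
  open-up : ∀ {n} (3≤n : 3 ≤ suc n) ((f , _) : H ⊑ᵢ Cycle (suc n) 3≤n) → (∀ u → f u ≢ zero) → H ⊑ᵢ P n
  open-up {n} 3≤n (f , f-inj , p) ∌0 = g , (λ {u} {v} e → f-inj (trans (f≡ u) (trans (cong suc e) (sym (f≡ v))))) ,
    λ u v → mk⇔
      (λ a → toP (subst₂ (Adj (Cycle (suc n) 3≤n)) (f≡ u) (f≡ v) (Equivalence.to (p u v) a)))
      (λ a → Equivalence.from (p u v) (subst₂ (Adj (Cycle (suc n) 3≤n)) (sym (f≡ u)) (sym (f≡ v)) (fromP a)))
    where
    pred : ∀ u → ∃[ i ] f u ≡ suc i
    pred u with f u in eq
    ... | zero  = contradiction eq (∌0 u)
    ... | suc i = i , refl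

    g : Vertex H → Fin n
    g u = proj₁ (pred u)

    f≡ : ∀ u → f u ≡ suc (g u)
    f≡ u = proj₂ (pred u)

    toP : ∀ {i j} → Adj (Cycle (suc n) 3≤n) (suc i) (suc j) → Adj (P n) i j
    toP (inj₁ (inj₁ e)) = inj₁ (ℕ.suc-injective e)
    toP (inj₂ (inj₁ e)) = inj₂ (ℕ.suc-injective e)

    fromP : ∀ {i j} → Adj (P n) i j → Adj (Cycle (suc n) 3≤n) (suc i) (suc j)
    fromP (inj₁ e) = inj₁ (inj₁ (cong suc e))
    fromP (inj₂ e) = inj₂ (inj₁ (cong suc e))

  go : ∀ {n} {3≤n : 3 ≤ n} t (v : Fin n) → toℕ v ≡ t → ((f , _) : H ⊑ᵢ Cycle n 3≤n) →
       (∀ u → f u ≢ v) → ∃[ m ] H ⊑ᵢ P m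
  go {suc n} {3≤n} t       zero    _ ι v∉ = n , open-up 3≤n ι v∉
  go {suc n} {3≤n} (suc t) (suc v) e ι v∉ =
    go {3≤n = 3≤n} t (inject₁ v) (trans (F.toℕ-inject₁ v) (ℕ.suc-injective e))
      (⊑ᵢ-trans {H} {Cycle _ 3≤n} {Cycle _ 3≤n} ι (rotation 3≤n))
      (λ u e′ → v∉ u (proj₁ (proj₂ (rotation 3≤n)) {y = suc v} e′))

-- Telling stars, induced subgraphs of `Kʰ` and long paths apart

K₁,2≅P3 : (K₁, 2) ≅ P 3
K₁,2≅P3 = surjective⇒≅ {K₁, 2} {P 3}
  (toWitness {a? = (K₁, 2) ⊑ᵢ? P 3} _) (toWitness {a? = F.all? λ v → F.any? λ u → _ F.≟ v} _)

two-of-three : ∀ {A B : Fin 3 → Set} → (∀ i → A i ⊎ B i) →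
  (∀ i j → i ≢ j → A i → ¬ A j) → (∀ i j → i ≢ j → B i → ¬ B j) → ⊥
two-of-three s ¬A ¬B with s zero | s (suc zero) | s (suc (suc zero))
... | inj₁ a | inj₁ b | _      = ¬A zero (suc zero) (λ ()) a b
... | inj₁ a | inj₂ _ | inj₁ b = ¬A zero (suc (suc zero)) (λ ()) a b
... | inj₁ _ | inj₂ a | inj₂ b = ¬B (suc zero) (suc (suc zero)) (λ ()) a b
... | inj₂ _ | inj₁ a | inj₁ b = ¬A (suc zero) (suc (suc zero)) (λ ()) a b
... | inj₂ a | inj₁ _ | inj₂ b = ¬B zero (suc (suc zero)) (λ ()) a b
... | inj₂ a | inj₂ b | _      = ¬B zero (suc zero) (λ ()) a b

claw : ∀ {r G} → 3 ≤ r → (K₁, r) ⊑ᵢ G → ∃[ c ] Σ[ x ∈ (Fin 3 → Vertex G) ]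
  (∀ i → Adj G c (x i)) × (∀ i j → i ≢ j → Indep G (x i) (x j))
claw 3≤r (f , f-inj , p) = f zero , f ∘ leaf , (λ i → Equivalence.to (p zero (leaf i)) _) ,
  λ i j i≢j → (λ e → i≢j (F.inject≤-injective 3≤r 3≤r i j (F.suc-injective (f-inj e)))) ,
              Equivalence.from (p (leaf i) (leaf j))
  where
  leaf : Fin 3 → Fin _
  leaf i = suc (F.inject≤ i 3≤r)

-- Of three independent neighbours of a vertex at most one lies in the clique, and at most one is
-- pendant because no vertex has two pendant neighbours.
Kʰ-claw-free : ∀ {r n} → 3 ≤ r → ¬ ((K₁, r) ⊑ᵢ Kʰ n)
Kʰ-claw-free {r} {n} 3≤r ι with claw {G = Kʰ n} 3≤r ι
... | c , x , cx , xx = two-of-three {λ i → InClique (x i)} {λ i → ∃[ j ] F.splitAt n (x i) ≡ inj₂ j}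
    (λ i → side (F.splitAt n (x i)) refl) ¬cliques ¬pendants
  where
  InClique : Fin (n + n) → Set
  InClique v = ∃[ j ] F.splitAt n v ≡ inj₁ j

  side : ∀ {v} s → F.splitAt n v ≡ s → InClique v ⊎ ∃[ j ] F.splitAt n v ≡ inj₂ j
  side (inj₁ j) e = inj₁ (j , e)
  side (inj₂ j) e = inj₂ (j , e)

  ¬cliques : ∀ i j → i ≢ j → InClique (x i) → ¬ InClique (x j)
  ¬cliques i j i≢j (k , e) (l , e′) = proj₂ (xx i j i≢j) (subst₂ KʰAdj (sym e) (sym e′)
    λ k≡l → proj₁ (xx i j i≢j) (splitAt-injective n (trans e (trans (cong inj₁ k≡l) (sym e′)))))

  support : ∀ c {k l} → KʰAdj c (inj₂ k) → KʰAdj {n} c (inj₂ l) → k ≡ l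
  support (inj₁ _) refl refl = refl

  ¬pendants : ∀ i j → i ≢ j → ∃[ k ] F.splitAt n (x i) ≡ inj₂ k → ¬ (∃[ k ] F.splitAt n (x j) ≡ inj₂ k)
  ¬pendants i j i≢j (k , e) (l , e′) = proj₁ (xx i j i≢j) (splitAt-injective n (trans e (trans
    (cong inj₂ (support (F.splitAt n c) (subst (KʰAdj _) e (cx i)) (subst (KʰAdj _) e′ (cx j)))) (sym e′))))

P-claw-free : ∀ {r n} → 3 ≤ r → ¬ ((K₁, r) ⊑ᵢ P n)
P-claw-free {r} {n} 3≤r ι with claw {G = P n} 3≤r ι
... | c , x , cx , xx = two-of-three cx
  (λ i j i≢j e e′ → proj₁ (xx i j i≢j) (F.toℕ-injective (trans (sym e) e′)))
  (λ i j i≢j e e′ → proj₁ (xx i j i≢j) (F.toℕ-injective (ℕ.suc-injective (trans e (sym e′)))))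

-- The three inner vertices of P 5 have two neighbours each, so they would lie in the
-- clique, although the outer two of them are not adjacent.
Kʰ-P₅-free : ∀ {ℓ n} → 4 < ℓ → ¬ (P ℓ ⊑ᵢ Kʰ n)
Kʰ-P₅-free {ℓ} {n} 4<ℓ ι with ⊑ᵢ-trans {P 5} {P ℓ} {Kʰ n} (P-mono 4<ℓ) ι
... | f , f-inj , p = far
  (inner (at 0F) (at 1F) (at 2F) (adj 1F 0F (inj₂ refl)) (adj 1F 2F (inj₁ refl)) (distinct 0F 2F λ ()))
  (inner (at 2F) (at 3F) (at 4F) (adj 3F 2F (inj₂ refl)) (adj 3F 4F (inj₁ refl)) (distinct 2F 4F λ ()))
  where
  at : Fin 5 → Fin n ⊎ Fin n
  at i = F.splitAt n (f i)

  adj : ∀ i j → Adj (P 5) i j → KʰAdj (at i) (at j)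
  adj i j = Equivalence.to (p i j)

  distinct : ∀ i j → i ≢ j → at i ≢ at j
  distinct i j i≢j e = i≢j (f-inj (splitAt-injective n e))

  inner : ∀ a b c → KʰAdj b a → KʰAdj b c → a ≢ c → ∃[ k ] b ≡ inj₁ k
  inner a        (inj₁ k) c        _    _    _   = k , refl
  inner (inj₁ _) (inj₂ _) (inj₁ _) refl refl a≢c = contradiction refl a≢c

  far : ∃[ k ] at 1F ≡ inj₁ k → ¬ (∃[ k ] at 3F ≡ inj₁ k)
  far (k , e) (l , e′) with Equivalence.from (p 1F 3F) (subst₂ KʰAdj (sym e) (sym e′)
    λ k≡l → distinct 1F 3F (λ ()) (trans e (trans (cong inj₁ k≡l) (sym e′))))
  ... | inj₁ ()
  ... | inj₂ ()

-- The two directions of the equivalence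

Any⇒lookup : ∀ {p} {Q : Graph → Set p} {F} → Any Q F → ∃[ i ] Q (lookup F i)
Any⇒lookup q = Any.index q , lookup-index q

lookup⇒Any : ∀ {p} {Q : Graph → Set p} F i → Q (lookup F i) → Any Q F
lookup⇒Any (H ∷ F) zero    q = here q
lookup⇒Any (H ∷ F) (suc i) q = there (lookup⇒Any F i q)

three-indices : (i j k : Fin 3) → i ≢ j → i ≢ k → j ≢ k → ∀ t → t ≡ i ⊎ t ≡ j ⊎ t ≡ k
three-indices = toWitness {a? = F.all? λ (i : Fin 3) → F.all? λ j → F.all? λ k →
  ¬? (i F.≟ j) →-dec ¬? (i F.≟ k) →-dec ¬? (j F.≟ k) →-dec
  F.all? λ t → (t F.≟ i) ⊎-dec (t F.≟ j) ⊎-dec (t F.≟ k)} _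

max-order : ∀ F → ∃[ m ] (∀ i → order (lookup F i) ≤ m)
max-order []      = 0 , λ ()
max-order (H ∷ F) =
  let m , le = max-order F
  in  order H ⊔ m , λ { zero → ℕ.m≤m⊔n _ m ; (suc i) → ℕ.≤-trans (le i) (ℕ.m≤n⊔m (order H) m) }

HasBound : List Graph → ℕ → Set₁
HasBound F C = ∀ G → Connected G → 3 ≤ order G → Free F G →
               ∀ k d → Rx₃ G k → Sdiam₃ G d → k ≤ d + C

module _ {F : List Graph} {C : ℕ} (bound : HasBound F C) where

  contains-star-subgraph : ∃[ n ] ∃[ i ] lookup F i ⊑ᵢ (K₁, n)
  contains-star-subgraph = n , Any⇒lookup (forbidden-occurs (K₁, n) conn 3≤ {L = n}
    (reach⇒smallTrees (star-reach n)) (star-colours (ℕ.m≤m+n 3 _)) ℕ.≤-refl (bound (K₁, n) conn 3≤))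
    where
    -- Radius 1 gives trees of size at most 3 * 1 + 1 = 4, and `n` must exceed this by more than
    -- `C`.
    n = suc (4 + C)
    conn = reach⇒connected (star-reach n)
    3≤ = s≤s (s≤s (s≤s z≤n))

  contains-Kʰ-subgraph : ∃[ n ] 3 ≤ n × ∃[ i ] lookup F i ⊑ᵢ Kʰ n
  contains-Kʰ-subgraph = n , ℕ.m≤m+n 3 _ , Any⇒lookup (forbidden-occurs (Kʰ n) conn 3≤ {L = n}
    (reach⇒smallTrees (Kʰ-reach _)) (Kʰ-colours (ℕ.m≤m+n 3 _)) ℕ.≤-refl (bound (Kʰ n) conn 3≤))
    where
    -- Here the radius is 2, and 3 * 2 + 1 = 7.
    n = suc (7 + C)
    conn = reach⇒connected (Kʰ-reach (7 + C))
    3≤ = ℕ.m≤m+n 3 _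

  contains-path-subgraph : All Connected F → All (λ H → 3 ≤ order H) F →
                           ∃[ i ] ∃[ ℓ ] lookup F i ≅ P ℓ
  contains-path-subgraph conns orders =
    let i , ι = Any⇒lookup (forbidden-occurs G (cycle-connected 3≤n) 3≤n
                  (cycle-smallTrees M 3≤n) (cycle-colours 3≤n) gap (bound G (cycle-connected 3≤n) 3≤n))
        m , ι′ = cycle-subgraph {lookup F i} 3≤n (ℕ.≤-<-trans (≤N i) N<n) ι
    in  i , path-subgraph {lookup F i} (All.lookup conns (∈-lookup i))
              (ℕ.≤-trans (s≤s z≤n) (All.lookup orders (∈-lookup i))) m ι′
    where
    N = proj₁ (max-order F)
    ≤N = proj₂ (max-order F)
    -- `N` makes the cycle larger than every member of `F`. With m = M + 1, the gap 3m + 1 + C < 4m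
    -- - 2 amounts to m > C + 3.
    M = 3 + C + N
    n = 4 * suc M

    1+M≤n : suc M ≤ n
    1+M≤n = ℕ.m≤m+n (suc M) _

    N<n : N < n
    N<n = ℕ.≤-trans (s≤s (ℕ.m≤n+m N (3 + C))) 1+M≤n

    3≤n : 3 ≤ n
    3≤n = ℕ.≤-trans (ℕ.m≤m+n 3 _) 1+M≤n

    G = Cycle n 3≤n

    gap : suc (3 * suc M) + C < n ∸ 2
    gap = ℕ.m+n≤o⇒m≤o∸n _ (begin
      suc (suc (3 * suc M) + C) + 2  ≡⟨ ℕ.+-comm _ 2 ⟩
      2 + suc (suc (3 * suc M) + C)  ≡⟨ cong (4 +_) (ℕ.+-comm (3 * suc M) C) ⟩
      4 + (C + 3 * suc M)            ≤⟨ ℕ.+-monoˡ-≤ (3 * suc M) (ℕ.+-monoʳ-≤ 4 (ℕ.m≤m+n C N)) ⟩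
      suc M + 3 * suc M              ∎)
      where open ℕ.≤-Reasoning

≅⇒≤ : ∀ {H G} → H ≅ G → order H ≤ order G
≅⇒≤ {H} {G} φ = let f , f-inj , _ = ≅⇒⊑ᵢ {H} {G} φ in F.injective⇒≤ {f = f} f-inj

bound⇒family : ∀ F → length F ≡ 3 → All Connected F → All (λ H → 3 ≤ order H) F →
  (P 3 ∷ []) ⊈ F → (∀ r → 3 ≤ r → ((K₁, r) ∷ P 4 ∷ []) ⊈ F) → ∀ {C} → HasBound F C →
  ∃[ r ] ∃[ s ] ∃[ ℓ ] ∃[ Y ]
    3 ≤ r × 3 ≤ s × 4 < ℓ × Y ⊑ᵢ Kʰ s × F ≐ ((K₁, r) ∷ Y ∷ P ℓ ∷ [])
bound⇒family F@(H₁ ∷ H₂ ∷ H₃ ∷ []) refl conns orders ∌P₃ ∌K₁P₄ bound =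
  let n , i , ι = contains-star-subgraph bound
      s , 3≤s , j , κ = contains-Kʰ-subgraph bound
      k , ℓ , π = contains-path-subgraph bound conns orders
      r , σ = star-subgraph {lookup F i} (All.lookup conns (∈-lookup i))
                (ℕ.≤-trans (ℕ.n≤1+n 2) (order≥3 i)) ι
  in  family i j k σ (star≥3 i r σ) 3≤s κ π
  where
  order≥3 : ∀ i → 3 ≤ order (lookup F i)
  order≥3 i = All.lookup orders (∈-lookup i)

  ∌P₃′ : ∀ i → ¬ (P 3 ≅ lookup F i)
  ∌P₃′ i e = ∌P₃ λ {x} → λ { (here x≅P₃) → lookup⇒Any F i (≅-trans {x} {P 3} {lookup F i} x≅P₃ e) }

  star≥3 : ∀ i r → lookup F i ≅ (K₁, r) → 3 ≤ r
  star≥3 i (suc (suc (suc r))) σ = s≤s (s≤s (s≤s z≤n))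
  star≥3 i (suc (suc zero)) σ = contradiction
    (≅-trans {P 3} {K₁, 2} {lookup F i} (≅-sym {K₁, 2} {P 3} K₁,2≅P3) (≅-sym {lookup F i} {K₁, 2} σ)) (∌P₃′ i)
  star≥3 i (suc zero) σ with s≤s (s≤s ()) ← ℕ.≤-trans (order≥3 i) (≅⇒≤ {lookup F i} {K₁, 1} σ)
  star≥3 i zero       σ with s≤s () ← ℕ.≤-trans (order≥3 i) (≅⇒≤ {lookup F i} {K₁, 0} σ)

  path≥5 : ∀ r → 3 ≤ r → ∀ i → lookup F i ≅ (K₁, r) → ∀ k ℓ → lookup F k ≅ P ℓ → 4 < ℓ
  path≥5 r 3≤r i σ k (suc (suc (suc (suc (suc ℓ))))) π = s≤s (s≤s (s≤s (s≤s (s≤s z≤n))))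
  -- The star found in `F` and this path would form the excluded pair.
  path≥5 r 3≤r i σ k 4 π = contradiction
    (λ {x} → λ { (here e) → lookup⇒Any F i
                   (≅-trans {x} {K₁, r} {lookup F i} e (≅-sym {lookup F i} {K₁, r} σ))
               ; (there (here e)) → lookup⇒Any F k
                   (≅-trans {x} {P 4} {lookup F k} e (≅-sym {lookup F k} {P 4} π)) })
    (∌K₁P₄ r 3≤r)
  path≥5 r 3≤r i σ k 3 π = contradiction (≅-sym {lookup F k} {P 3} π) (∌P₃′ k)
  path≥5 r 3≤r i σ k 2 π with s≤s (s≤s ()) ← ℕ.≤-trans (order≥3 k) (≅⇒≤ {lookup F k} {P 2} π)
  path≥5 r 3≤r i σ k 1 π with s≤s () ← ℕ.≤-trans (order≥3 k) (≅⇒≤ {lookup F k} {P 1} π)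
  path≥5 r 3≤r i σ k 0 π with () ← ℕ.≤-trans (order≥3 k) (≅⇒≤ {lookup F k} {P 0} π)

  members : ∀ i j k → (∀ t → t ≡ i ⊎ t ≡ j ⊎ t ≡ k) → ∀ {r ℓ} →
    lookup F i ≅ (K₁, r) → lookup F k ≅ P ℓ → F ⊆ ((K₁, r) ∷ lookup F j ∷ P ℓ ∷ [])
  members i j k cover {r} {ℓ} σ π {x} x∈F with Any⇒lookup x∈F
  ... | t , e with cover t
  ...   | inj₁ refl        = here (≅-trans {x} {lookup F i} {K₁, r} e σ)
  ...   | inj₂ (inj₁ refl) = there (here e)
  ...   | inj₂ (inj₂ refl) = there (there (here (≅-trans {x} {lookup F k} {P ℓ} e π)))

  family : ∀ i j k {r s ℓ} → lookup F i ≅ (K₁, r) → 3 ≤ r → 3 ≤ s → lookup F j ⊑ᵢ Kʰ s →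
    lookup F k ≅ P ℓ → ∃[ r ] ∃[ s ] ∃[ ℓ ] ∃[ Y ]
      3 ≤ r × 3 ≤ s × 4 < ℓ × Y ⊑ᵢ Kʰ s × F ≐ ((K₁, r) ∷ Y ∷ P ℓ ∷ [])
  family i j k {r} {s} {ℓ} σ 3≤r 3≤s κ π =
    r , s , ℓ , lookup F j , 3≤r , 3≤s , 4<ℓ , κ ,
    (λ {x} → members i j k (three-indices i j k i≢j i≢k j≢k) σ π {x}) ,
    λ {x} → λ { (here e)                 → lookup⇒Any F i (≅-trans {x} {K₁, r} {lookup F i} e σ⁻¹)
              ; (there (here e))         → lookup⇒Any F j e
              ; (there (there (here e))) → lookup⇒Any F k (≅-trans {x} {P ℓ} {lookup F k} e π⁻¹) }
    where
    σ⁻¹ = ≅-sym {lookup F i} {K₁, r} σ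
    π⁻¹ = ≅-sym {lookup F k} {P ℓ} π
    4<ℓ = path≥5 r 3≤r i σ k ℓ π

    i≢j : i ≢ j
    i≢j refl = Kʰ-claw-free 3≤r (⊑ᵢ-trans {K₁, r} {lookup F i} {Kʰ s} (≅⇒⊑ᵢ {K₁, r} {lookup F i} σ⁻¹) κ)

    i≢k : i ≢ k
    i≢k refl = P-claw-free 3≤r (≅⇒⊑ᵢ {K₁, r} {P ℓ} (≅-trans {K₁, r} {lookup F i} {P ℓ} σ⁻¹ π))

    j≢k : j ≢ k
    j≢k refl = Kʰ-P₅-free 4<ℓ (⊑ᵢ-trans {P ℓ} {lookup F j} {Kʰ s} (≅⇒⊑ᵢ {P ℓ} {lookup F j} π⁻¹) κ)

family⇒bound : ∀ F → ∃[ r ] ∃[ s ] ∃[ ℓ ] ∃[ Y ]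
    3 ≤ r × 3 ≤ s × 4 < ℓ × Y ⊑ᵢ Kʰ s × F ≐ ((K₁, r) ∷ Y ∷ P ℓ ∷ []) →
  ∃[ C ] HasBound F C
family⇒bound F (r , s , ℓ , Y , _ , 3≤s , _ , κ , _ , ⊆F) =
  N * N , λ G conn 3≤n free k d rx _ →
    let avoid : ∀ {H} → Any (H ≅_) F → ¬ (H ⊑ᵢ G)
        avoid = λ {H} H∈F ι → let i , e = Any⇒lookup H∈F in
          All.lookup free (∈-lookup i) (⊑ᵢ-trans {lookup F i} {H} {G}
            (≅⇒⊑ᵢ {lookup F i} {H} (≅-sym {H} {lookup F i} e)) ι)
        c = boundedRainbowColouring {G} conn (F.inject≤ zero 3≤n)
              (avoid {K₁, r} (⊆F {K₁, r} (here (≅-refl {K₁, r}))))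
              (ℕ.≤-trans (ℕ.n≤1+n 2) 3≤s)
              (λ ι → avoid {Y} (⊆F {Y} (there (here (≅-refl {Y})))) (⊑ᵢ-trans {Y} {Kʰ s} {G} κ ι))
              (avoid {P ℓ} (⊆F {P ℓ} (there (there (here (≅-refl {P ℓ}))))))
    in  ℕ.≤-trans (proj₂ rx (N * N) c) (ℕ.m≤n+m (N * N) d)
  where
  N = suc (core-order r s ℓ)

  ≅-refl : ∀ {G} → G ≅ G
  ≅-refl {G} = Setoid.refl ≅-setoid {G}

theorem8 : (F : List Graph) →
    length F ≡ 3 → Unique F → All Connected F →
    All (λ H → 3 ≤ Graph.order H) F →
    (P 3 ∷ []) ⊈ F →
    (∀ r → 3 ≤ r → ((K₁, r) ∷ P 4 ∷ []) ⊈ F) →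
    (∃[ C ] (∀ G → Connected G → 3 ≤ Graph.order G → Free F G →
    ∀ k d → Rx₃ G k → Sdiam₃ G d → k ≤ d + C))
    ⇔
    (∃[ r ] ∃[ s ] ∃[ ℓ ] ∃[ Y ]
    3 ≤ r × 3 ≤ s × 4 < ℓ × Y ⊑ᵢ Kʰ s
    × F ≐ ((K₁, r) ∷ Y ∷ P ℓ ∷ []))
theorem8 F len _ conns orders ∌P₃ ∌K₁P₄ =
  mk⇔ (λ (C , bound) → bound⇒family F len conns orders ∌P₃ ∌K₁P₄ bound) (family⇒bound F)
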